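{- Let $0<\epsilon<1/2$, let $r\ge 2$ be an integer, let $x\ge(1+\epsilon)(r+1)$ be a real number, let $\delta$ be a real number with $\delta<\left(\frac{\epsilon}{6r}\right)^2$, and let $G$ be an $r$-graph with $|G|=\binom{x}{r}$ edges and $K^r_{r+1}(G)>(1-\delta)\binom{x}{r+1}$. Then: (1) There is a set $S$ of $\lceil x\rceil$ vertices of $G$ such that all but at most $10r(\epsilon^{ -1}+1)\delta^{1/2}\binom{x}{r}$ edges of $G$ are contained in $S$. (2) There are at most $\delta^{1/2}x$ vertices $v$ with $d(v)>(1+\delta^{1/2})\binom{x-1}{r-1}$. (3) The vertices of degree less than $\binom{(1-\delta^{1/2})(x-1)}{r-1}$ are incident to at most $\delta^{1/2}x\binom{x-1}{r-1}$ edges. (4) There is a set $C$ of vertices of $G$ of size $|C|<(1+3r\delta^{1/2})x$ that contains at least $\binom{(1-4\delta^{1/2})x}{r+1}$ copies of $K^r_{r+1}$.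
   Context: An $r$-graph $G$ consists of a finite vertex set $V(G)$ and a set $E(G)$ of edges, each edge being an $r$-element subset of $V(G)$; $|G|=|E(G)|$. The degree $d(v)$ of a vertex $v$ is the number of edges containing $v$. A copy of $K^r_{r+1}$ in $G$ is an $(r+1)$-element subset of $V(G)$ all of whose $r$-element subsets are edges of $G$; $K^r_{r+1}(G)$ is the number of such copies, and a vertex set $C$ contains a copy if the $(r+1)$-set is a subset of $C$. For real $y$ and integer $k\ge 0$, $\binom{y}{k}=y(y-1)\cdots(y-k+1)/k!$. -}

module Defs where

open import Algebra.Bundles using (CommutativeRing; Semiring)
open import Algebra.Structures using (IsCommutativeRing)
open import Data.Fin.Base using (Fin)
open import Data.Fin.Properties using (any?)
open import Data.Fin.Subset using (Subset; inside; outside; _∈_; _⊆_; ∣_∣)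
open import Data.Fin.Subset.Properties using (anySubset?; _∈?_; _⊆?_)
open import Data.List.Base using (List; []; _∷_; _++_; map; filter; length; allFin)
open import Data.Nat.Base using (ℕ; zero; suc; _!)
open import Data.Nat.Properties using (_≟_)
open import Data.Product.Base using (∃; ∃-syntax; _×_; _,_)
import Data.Vec.Base as Vec
open import Level using (Level; 0ℓ; _⊔_) renaming (suc to lsuc)
open import Relation.Binary.Core using (Rel)
open import Relation.Binary.PropositionalEquality using (_≡_)
open import Relation.Binary.Structures using (IsDecTotalOrder)
open import Relation.Nullary using (Dec; ¬_)
open import Relation.Nullary.Decidable using (map′; decidable-stable; ¬?; _×-dec_; _→-dec_)
open import Relation.Unary using (Pred; Decidable)

------------------------------------------------------------------------
-- Real numbers

-- The classical axioms for ℝ, which determine it up to unique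
-- isomorphism.  The order is decidable and suprema exist for arbitrary
-- predicates, so a model lives in a classical metatheory; results
-- quantify over all models instead of fixing a construction.

record CompleteOrderedField (c ℓ : Level) : Set (lsuc (c ⊔ ℓ)) where
  infix  8 -_
  infix  9 _⁻¹
  infixl 7 _*_ _/_
  infixl 6 _+_ _-_
  infix  4 _≈_ _≤_

  field
    ℝ     : Set c
    _≈_   : Rel ℝ ℓ
    _≤_   : Rel ℝ ℓ
    _+_   : ℝ → ℝ → ℝ
    _*_   : ℝ → ℝ → ℝ
    -_    : ℝ → ℝ
    _⁻¹   : ℝ → ℝ
    0#    : ℝ
    1#    : ℝ

    isCommutativeRing : IsCommutativeRing _≈_ _+_ _*_ -_ 0# 1#
    0≉1               : ¬ (0# ≈ 1#)
    -- The value of 0# ⁻¹ is unspecified.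
    *-inverseʳ        : ∀ x → ¬ (x ≈ 0#) → (x * x ⁻¹) ≈ 1#

    isDecTotalOrder   : IsDecTotalOrder _≈_ _≤_
    +-monoˡ-≤         : ∀ z {x y} → x ≤ y → (x + z) ≤ (y + z)
    *-nonNeg          : ∀ {x y} → 0# ≤ x → 0# ≤ y → 0# ≤ (x * y)

  UpperBound : Pred ℝ (c ⊔ ℓ) → ℝ → Set (c ⊔ ℓ)
  UpperBound P u = ∀ x → P x → x ≤ u

  field
    supremum : (P : Pred ℝ (c ⊔ ℓ)) → ∃ P → ∃ (UpperBound P) →
               ∃[ s ] UpperBound P s × (∀ u → UpperBound P u → s ≤ u)

  commutativeRing : CommutativeRing c ℓ
  commutativeRing = record { isCommutativeRing = isCommutativeRing }

  -- x < y unfolds to x ≤ y × ¬ (x ≈ y).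
  open import Relation.Binary.Construct.NonStrictToStrict _≈_ _≤_ public
    using (_<_)

  infix 4 _<?_
  _<?_ : ∀ x y → Dec (x < y)
  _<?_ = <-decidable _≟ℝ_ _≤?_
    where
    open import Relation.Binary.Construct.NonStrictToStrict _≈_ _≤_ using (<-decidable)
    open IsDecTotalOrder isDecTotalOrder using (_≤?_) renaming (_≟_ to _≟ℝ_)

  open import Algebra.Definitions.RawSemiring
    (Semiring.rawSemiring (CommutativeRing.semiring commutativeRing)) public
    using (_^_) renaming (_×_ to _·_)

  _-_ : ℝ → ℝ → ℝ
  x - y = x + (- y)

  _/_ : ℝ → ℝ → ℝ
  x / y = x * y ⁻¹

  fromℕ : ℕ → ℝ
  fromℕ n = n · 1#

  -- fallingFactorial y k = y (y - 1) ⋯ (y - k + 1)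
  fallingFactorial : ℝ → ℕ → ℝ
  fallingFactorial y zero    = 1#
  fallingFactorial y (suc k) = fallingFactorial y k * (y - fromℕ k)

  binom : ℝ → ℕ → ℝ
  binom y k = fallingFactorial y k / fromℕ (k !)

  -- s = √ y; such an s is unique, and exists exactly when 0# ≤ y.
  IsSqrt : ℝ → ℝ → Set ℓ
  IsSqrt s y = 0# ≤ s × (s ^ 2) ≈ y

  -- k = ⌈ x ⌉, for x > -1
  IsCeiling : ℕ → ℝ → Set ℓ
  IsCeiling k x = x ≤ fromℕ k × fromℕ k < (x + 1#)

------------------------------------------------------------------------
-- Counting

private
  variable
    n : ℕ
    p : Level

-- Every subset of Fin n, exactly once.
subsets : ∀ n → List (Subset n)
subsets zero    = Vec.[] ∷ []
subsets (suc n) = map (Vec._∷_ outside) (subsets n) ++ map (Vec._∷_ inside) (subsets n)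

#subsets : {P : Pred (Subset n) p} → Decidable P → ℕ
#subsets {n = n} P? = length (filter P? (subsets n))

#vertices : {P : Pred (Fin n) p} → Decidable P → ℕ
#vertices {n = n} P? = length (filter P? (allFin n))

allSubset? : {P : Pred (Subset n) p} → Decidable P → Dec (∀ S → P S)
allSubset? P? =
  map′ (λ ¬∃¬P S → decidable-stable (P? S) (λ ¬PS → ¬∃¬P (S , ¬PS)))
       (λ ∀P (S , ¬PS) → ¬PS (∀P S))
       (¬? (anySubset? (λ S → ¬? (P? S))))

------------------------------------------------------------------------
-- r-graphs

record RGraph (r : ℕ) : Set₁ where
  field
    order   : ℕ
    Edge    : Pred (Subset order) 0ℓ
    Edge?   : Decidable Edge
    uniform : ∀ {S} → Edge S → ∣ S ∣ ≡ r

  V : Set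
  V = Fin order

  size : ℕ
  size = #subsets Edge?

  degree : V → ℕ
  degree v = #subsets (λ S → Edge? S ×-dec v ∈? S)

  -- T spans a copy of K^r_{r+1}.
  IsClique : Pred (Subset order) 0ℓ
  IsClique T = ∣ T ∣ ≡ suc r × (∀ S → S ⊆ T → ∣ S ∣ ≡ r → Edge S)

  IsClique? : Decidable IsClique
  IsClique? T = (∣ T ∣ ≟ suc r) ×-dec
    allSubset? (λ S → (S ⊆? T) →-dec ((∣ S ∣ ≟ r) →-dec Edge? S))

  cliques : ℕ
  cliques = #subsets IsClique?

  cliquesIn : Subset order → ℕ
  cliquesIn C = #subsets (λ T → IsClique? T ×-dec T ⊆? C)

  edgesNotIn : Subset order → ℕ
  edgesNotIn S = #subsets (λ e → Edge? e ×-dec ¬? (e ⊆? S))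

  Incident : Pred V p → Subset order → Set p
  Incident P e = ∃[ v ] P v × v ∈ e

  edgesIncidentTo : {P : Pred V p} → Decidable P → ℕ
  edgesIncidentTo P? =
    #subsets (λ e → Edge? e ×-dec any? (λ v → P? v ×-dec v ∈? e))

{-# OPTIONS --safe #-}
module Submission where

-- The copies of K^r_{r+1} through v number at most |G| - d(v), and at
-- most the copies of K^{r-1}_r in the link of v.  Bounding them by the
-- first count when d(v) ≥ binom(x-1, r-1) and inductively by the second
-- otherwise shows that every vertex has nonnegative defect
-- (x - r) d(v) - r K(v), K(v) being the number of copies through v; this
-- proves the Kruskal–Katona theorem on summing over v.
--
-- Put s = √δ and D = binom(x-1, r-1), so that r |G| = x D.  Under the
-- hypotheses the defects sum to less than s² (x - r) x D.  A vertex of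
-- degree above (1 + s) D has defect at least x s D, and one of degree
-- d(v) < binom((1 - s)(x - 1), r-1) has defect at least s (x - 1) d(v),
-- whence (2) and (3).
--
-- For (1) and (4), a vertex of degree d ≤ D has defect at least
-- (x - r + 1) (D - d) d / ((r - 1) D).  So the set C of vertices of degree
-- at least D / 2 has at most x (1 + 2 (r - 1) s²) elements, and the other
-- vertices have total degree at most 2 (r - 1) s² x D.  While C has more
-- than x elements, it contains a vertex of degree at most D, since all
-- degrees sum to x D; deleting such vertices cuts C down to ⌈x⌉.

open import Defs
open import Data.Fin.Subset using (∣_∣)
open import Data.Nat.Base using (ℕ; _∸_) renaming (_≤_ to _≤ℕ_; _+_ to _+ℕ_)
open import Data.Product.Base using (_×_; ∃-syntax)

open import Algebra.Bundles using (CommutativeRing)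
import Algebra.Properties.CommutativeMonoid.Sum
import Algebra.Properties.CommutativeSemigroup
import Algebra.Properties.Ring
import Algebra.Properties.Semiring.Mult
import Algebra.Properties.Semiring.Sum
import Algebra.Solver.Ring
open import Algebra.Solver.Ring.AlmostCommutativeRing
  using (fromCommutativeRing; Induced-equivalence; _-Raw-AlmostCommutative⟶_)
open import Data.Bool.Base using (true; false; not; if_then_else_)
open import Data.Empty using (⊥-elim)
open import Data.Fin.Base using (Fin; zero; suc)
import Data.Fin.Properties as Finₚ
open import Data.Fin.Subset using (Subset; inside; outside; _∈_; _∉_; _⊆_; ⊤; ⊥)
open import Data.Fin.Subset.Properties using (_∈?_; _⊆?_; p⊆q⇒∣p∣≤∣q∣; ∣⊤∣≡n; ⊥⊆; ∣⊥∣≡0)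
open import Data.Integer.Base as ℤ using (ℤ; +_; -[1+_])
import Data.Integer.Properties as ℤₚ
open import Data.List.Base as List using (List; []; _∷_; length; filter; tabulate)
import Data.List.Properties as Listₚ
open import Data.Maybe.Base using (just; nothing)
open import Data.Nat.Base as ℕ using (zero; suc; _!; z≤n; s≤s)
import Data.Nat.Properties as ℕₚ
open import Data.Product.Base using (_,_; proj₁; proj₂)
open import Data.Sum.Base using (inj₁; inj₂)
open import Data.Vec.Base as Vec using (here; there)
import Data.Vec.Properties as Vecₚ
open import Function.Base using (_∘_; id)
open import Level using (Level)
open import Relation.Binary.Bundles using (Poset)
open import Relation.Binary.Definitions using (WeaklyDecidable)
open import Relation.Binary.PropositionalEquality as ≡ using (_≡_; _≢_; cong; cong₂)
open import Relation.Binary.Structures using (IsDecTotalOrder)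
open import Relation.Nullary using (Dec; yes; no; ¬_; does)
open import Relation.Nullary.Decidable using (dec-true; dec-false; decidable-stable; ¬?; _×-dec_; _→-dec_)
open import Relation.Unary using (Pred; Decidable)

open Algebra.Properties.CommutativeMonoid.Sum ℕₚ.+-0-commutativeMonoid
  using (sum; sum-cong-≗; ∑-distrib-+; sum-replicate-zero)
open Algebra.Properties.CommutativeSemigroup ℕₚ.+-commutativeSemigroup using (interchange)

-- Ordered-field arithmetic and a ring solver

module OrderedField {c ℓ} (F : CompleteOrderedField c ℓ) where
  open CompleteOrderedField F public
  open CommutativeRing commutativeRing public
    using (refl; sym; trans; reflexive; setoid; +-cong; +-congˡ; +-congʳ; *-cong; *-congˡ; *-congʳ;
           -‿cong; +-identityˡ; +-identityʳ; *-identityˡ; *-identityʳ; *-comm; *-assoc; +-assoc;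
             +-comm; zeroˡ; zeroʳ;
           -‿inverseʳ; semiring; ring; +-commutativeMonoid)
  open IsDecTotalOrder isDecTotalOrder public
    using (isPartialOrder; antisym; total; _≤?_)
    renaming (trans to ≤-trans; reflexive to ≤-reflexive; refl to ≤-refl)
  open Algebra.Properties.Semiring.Mult semiring using (×-homo-+; ×1-homo-*)
  open Algebra.Properties.Ring ring using
    (-‿distribˡ-*; -‿distribʳ-*; -‿involutive; -0#≈0#; -‿+-comm)

  poset : Poset c ℓ ℓ
  poset = record { isPartialOrder = isPartialOrder }

  fromℕ-+ : ∀ m n → fromℕ (m ℕ.+ n) ≈ fromℕ m + fromℕ n
  fromℕ-+ = ×-homo-+ 1#

  fromℕ-* : ∀ m n → fromℕ (m ℕ.* n) ≈ fromℕ m * fromℕ n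
  fromℕ-* = ×1-homo-*

  -- The solver must compare its coefficients, and equality in an abstract field does not evaluate;
  -- integers mapped in by a ring homomorphism do.
  fromℤ : ℤ → ℝ
  fromℤ (+ n)    = fromℕ n
  fromℤ -[1+ n ] = - fromℕ (suc n)

  open import Relation.Binary.Reasoning.Setoid setoid

  fromℤ-⊖ : ∀ m n → fromℤ (m ℤ.⊖ n) ≈ fromℕ m - fromℕ n
  fromℤ-⊖ m       zero    = sym (trans (+-congˡ -0#≈0#) (+-identityʳ _))
  fromℤ-⊖ zero    (suc n) = sym (+-identityˡ _)
  fromℤ-⊖ (suc m) (suc n) = begin
    fromℤ (suc m ℤ.⊖ suc n)               ≡⟨ ≡.cong fromℤ (ℤₚ.[1+m]⊖[1+n]≡m⊖n m n) ⟩
    fromℤ (m ℤ.⊖ n)                       ≈⟨ fromℤ-⊖ m n ⟩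
    fromℕ m - fromℕ n
      ≈⟨ +-congʳ (sym (trans (+-congʳ (-‿inverseʳ 1#)) (+-identityˡ _))) ⟩
    (1# - 1# + fromℕ m) - fromℕ n
      ≈⟨ +-congʳ (trans (+-assoc _ _ _) (trans (+-congˡ (+-comm _ _)) (sym (+-assoc _ _ _)))) ⟩
    ((1# + fromℕ m) - 1#) - fromℕ n       ≈⟨ +-assoc _ _ _ ⟩
    (1# + fromℕ m) + (- 1# - fromℕ n)     ≈⟨ +-congˡ (-‿+-comm _ _) ⟩
    (1# + fromℕ m) - (1# + fromℕ n)       ∎

  fromℤ-+ : ∀ i j → fromℤ (i ℤ.+ j) ≈ fromℤ i + fromℤ j
  fromℤ-+ (+ m)    (+ n)    = fromℕ-+ m n
  fromℤ-+ (+ m)    -[1+ n ] = fromℤ-⊖ m (suc n)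
  fromℤ-+ -[1+ m ] (+ n)    = trans (fromℤ-⊖ n (suc m)) (+-comm _ _)
  fromℤ-+ -[1+ m ] -[1+ n ] = begin
    - fromℕ (suc (suc (m ℕ.+ n)))         ≡⟨ ≡.cong (λ k → - fromℕ (suc k)) (≡.sym (ℕₚ.+-suc m n)) ⟩
    - fromℕ (suc m ℕ.+ suc n)             ≈⟨ -‿cong (fromℕ-+ (suc m) (suc n)) ⟩
    - (fromℕ (suc m) + fromℕ (suc n))     ≈⟨ sym (-‿+-comm _ _) ⟩
    - fromℕ (suc m) - fromℕ (suc n)       ∎

  fromℤ-neg : ∀ i → fromℤ (ℤ.- i) ≈ - fromℤ i
  fromℤ-neg (+ zero)  = sym -0#≈0#
  fromℤ-neg (+ suc n) = refl
  fromℤ-neg -[1+ n ]  = sym (-‿involutive _)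

  fromℤ-*-+ : ∀ i n → fromℤ (i ℤ.* + n) ≈ fromℤ i * fromℕ n
  fromℤ-*-+ (+ m)    n = trans (reflexive (≡.cong fromℤ (≡.sym (ℤₚ.pos-* m n)))) (fromℕ-* m n)
  fromℤ-*-+ -[1+ m ] n = begin
    fromℤ (-[1+ m ] ℤ.* + n)
      ≡⟨ ≡.cong fromℤ (≡.sym (ℤₚ.neg-distribˡ-* (+ suc m) (+ n))) ⟩
    fromℤ (ℤ.- (+ suc m ℤ.* + n))         ≈⟨ fromℤ-neg (+ suc m ℤ.* + n) ⟩
    - fromℤ (+ suc m ℤ.* + n)             ≈⟨ -‿cong (fromℤ-*-+ (+ suc m) n) ⟩
    - (fromℕ (suc m) * fromℕ n)           ≈⟨ -‿distribˡ-* _ _ ⟩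
    - fromℕ (suc m) * fromℕ n             ∎

  fromℤ-* : ∀ i j → fromℤ (i ℤ.* j) ≈ fromℤ i * fromℤ j
  fromℤ-* i (+ n)    = fromℤ-*-+ i n
  fromℤ-* i -[1+ n ] = begin
    fromℤ (i ℤ.* -[1+ n ])                ≡⟨ ≡.cong fromℤ (≡.sym (ℤₚ.neg-distribʳ-* i (+ suc n))) ⟩
    fromℤ (ℤ.- (i ℤ.* + suc n))           ≈⟨ fromℤ-neg (i ℤ.* + suc n) ⟩
    - fromℤ (i ℤ.* + suc n)               ≈⟨ -‿cong (fromℤ-*-+ i (suc n)) ⟩
    - (fromℤ i * fromℕ (suc n))           ≈⟨ -‿distribʳ-* _ _ ⟩
    fromℤ i * - fromℕ (suc n)             ∎

  -- Agrees with fromℤ, but sends + 1 to 1# itself rather than to 1# + 0#,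
  -- so that the solver's constant con (+ 1) can stand for 1#.
  coefficient : ℤ → ℝ
  coefficient (+ 1) = 1#
  coefficient i     = fromℤ i

  coefficient≈fromℤ : ∀ i → coefficient i ≈ fromℤ i
  coefficient≈fromℤ (+ 0)           = refl
  coefficient≈fromℤ (+ 1)           = sym (+-identityʳ 1#)
  coefficient≈fromℤ (+ suc (suc n)) = refl
  coefficient≈fromℤ -[1+ n ]        = refl

  coefficient-morphism : ℤ.+-*-rawRing -Raw-AlmostCommutative⟶ fromCommutativeRing commutativeRing
  coefficient-morphism = record
    { ⟦_⟧    = coefficient
    ; +-homo = λ i j → trans (coefficient≈fromℤ (i ℤ.+ j)) (trans (fromℤ-+ i j)
                 (sym (+-cong (coefficient≈fromℤ i) (coefficient≈fromℤ j))))
    ; *-homo = λ i j → trans (coefficient≈fromℤ (i ℤ.* j)) (trans (fromℤ-* i j)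
                 (sym (*-cong (coefficient≈fromℤ i) (coefficient≈fromℤ j))))
    ; -‿homo = λ i → trans (coefficient≈fromℤ (ℤ.- i)) (trans (fromℤ-neg i)
                 (sym (-‿cong (coefficient≈fromℤ i))))
    ; 0-homo = refl
    ; 1-homo = refl
    }

  coefficient-≟ : WeaklyDecidable (Induced-equivalence coefficient-morphism)
  coefficient-≟ i j with i ℤₚ.≟ j
  ... | yes ≡.refl = just refl
  ... | no  _      = nothing

  module Solver = Algebra.Solver.Ring ℤ.+-*-rawRing
    (fromCommutativeRing commutativeRing) coefficient-morphism
    coefficient-≟
  open Solver public using (solve; _:=_; _:+_; _:*_; _:-_; :-_; con)

  -- Most inequalities below are certified this way: the surplus `t` is built from visibly
  -- nonnegative pieces, and the ring solver checks the identity.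
  ≤-from-difference : ∀ {a b t} → 0# ≤ t → b ≈ a + t → a ≤ b
  ≤-from-difference {a} {b} {t} 0≤t b≈a+t =
    ≤-respˡ (+-identityˡ a) (≤-respʳ (trans (+-comm t a) (sym b≈a+t)) (+-monoˡ-≤ a 0≤t))
    where
    ≤-respˡ : ∀ {u v w} → u ≈ v → u ≤ w → v ≤ w
    ≤-respˡ u≈v u≤w = ≤-trans (≤-reflexive (sym u≈v)) u≤w
    ≤-respʳ : ∀ {u v w} → u ≈ v → w ≤ u → w ≤ v
    ≤-respʳ u≈v w≤u = ≤-trans w≤u (≤-reflexive u≈v)

  difference-nonNeg : ∀ {a b} → a ≤ b → 0# ≤ b - a
  difference-nonNeg {a} {b} a≤b = ≤-trans (≤-reflexive (sym (-‿inverseʳ a))) (+-monoˡ-≤ (- a) a≤b)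

  +-mono-≤ : ∀ {a b c d} → a ≤ b → c ≤ d → a + c ≤ b + d
  +-mono-≤ {a} {b} {c} {d} a≤b c≤d = ≤-trans (+-monoˡ-≤ c a≤b)
    (≤-trans (≤-reflexive (+-comm b c)) (≤-trans (+-monoˡ-≤ b c≤d) (≤-reflexive (+-comm d b))))

  +-nonNeg : ∀ {a b} → 0# ≤ a → 0# ≤ b → 0# ≤ a + b
  +-nonNeg 0≤a 0≤b = ≤-trans (≤-reflexive (sym (+-identityˡ 0#))) (+-mono-≤ 0≤a 0≤b)

  *-monoʳ-≤ : ∀ {a b c} → 0# ≤ c → a ≤ b → a * c ≤ b * c
  *-monoʳ-≤ {a} {b} {c} 0≤c a≤b = ≤-from-difference (*-nonNeg (difference-nonNeg a≤b) 0≤c)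
    (solve 3 (λ a b c → b :* c := a :* c :+ (b :- a) :* c) refl a b c)

  *-monoˡ-≤ : ∀ {a b c} → 0# ≤ c → a ≤ b → c * a ≤ c * b
  *-monoˡ-≤ {a} {b} {c} 0≤c a≤b = ≤-from-difference (*-nonNeg 0≤c (difference-nonNeg a≤b))
    (solve 3 (λ a b c → c :* b := c :* a :+ c :* (b :- a)) refl a b c)

  *-mono-≤ : ∀ {a b c d} → 0# ≤ c → 0# ≤ b → a ≤ b → c ≤ d → a * c ≤ b * d
  *-mono-≤ 0≤c 0≤b a≤b c≤d = ≤-trans (*-monoʳ-≤ 0≤c a≤b) (*-monoˡ-≤ 0≤b c≤d)

  ≰⇒> : ∀ {a b} → ¬ a ≤ b → b < a
  ≰⇒> {a} {b} a≰b with total a b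
  ... | inj₁ a≤b = ⊥-elim (a≰b a≤b)
  ... | inj₂ b≤a = b≤a , λ b≈a → a≰b (≤-reflexive (sym b≈a))

  <⇒≱ : ∀ {a b} → a < b → ¬ b ≤ a
  <⇒≱ (a≤b , a≉b) b≤a = a≉b (antisym a≤b b≤a)

  ≤-<-trans : ∀ {a b c} → a ≤ b → b < c → a < c
  ≤-<-trans a≤b b<c = ≰⇒> (λ c≤a → <⇒≱ b<c (≤-trans c≤a a≤b))

  <-≤-trans : ∀ {a b c} → a < b → b ≤ c → a < c
  <-≤-trans a<b b≤c = ≰⇒> (λ c≤a → <⇒≱ a<b (≤-trans b≤c c≤a))

  difference-pos : ∀ {a b} → a < b → 0# < b - a
  difference-pos {a} {b} (a≤b , a≉b) = difference-nonNeg a≤b , λ 0≈b-a → a≉b (trans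
    (trans (sym (+-identityʳ a)) (+-congˡ 0≈b-a)) (solve 2 (λ a b → a :+ (b :- a) := b) refl a b))

  <-from-difference : ∀ {a b t} → 0# < t → b ≈ a + t → a < b
  <-from-difference {a} {b} {t} (0≤t , 0≉t) b≈a+t = ≤-from-difference 0≤t b≈a+t , λ a≈b → 0≉t (trans
    (sym (-‿inverseʳ a)) (trans (+-congʳ (trans a≈b b≈a+t))
      (solve 2 (λ a t → (a :+ t) :- a := t) refl a t)))

  square-nonNeg : ∀ a → 0# ≤ a * a
  square-nonNeg a with total 0# a
  ... | inj₁ 0≤a = *-nonNeg 0≤a 0≤a
  ... | inj₂ a≤0 = ≤-trans (*-nonNeg 0≤-a 0≤-a)
    (≤-reflexive (solve 1 (λ a → (con (+ 0) :- a) :* (con (+ 0) :- a) := a :* a) refl a))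
    where
    0≤-a : 0# ≤ 0# - a
    0≤-a = difference-nonNeg a≤0

  0<1 : 0# < 1#
  0<1 = ≤-trans (square-nonNeg 1#) (≤-reflexive (*-identityˡ 1#)) , 0≉1

  pos⇒≉0 : ∀ {a} → 0# < a → ¬ a ≈ 0#
  pos⇒≉0 (_ , 0≉a) a≈0 = 0≉a (sym a≈0)

  *-pos : ∀ {a b} → 0# < a → 0# < b → 0# < a * b
  *-pos {a} {b} 0<a 0<b = *-nonNeg (proj₁ 0<a) (proj₁ 0<b) , λ 0≈ab → pos⇒≉0 0<b (begin
    b                ≈⟨ sym (*-identityˡ b) ⟩
    1# * b           ≈⟨ *-congʳ (sym (*-inverseʳ a (pos⇒≉0 0<a))) ⟩
    (a * a ⁻¹) * b   ≈⟨ solve 3 (λ a i b → (a :* i) :* b := i :* (a :* b)) refl a (a ⁻¹) b ⟩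
    a ⁻¹ * (a * b)   ≈⟨ *-congˡ (sym 0≈ab) ⟩
    a ⁻¹ * 0#        ≈⟨ zeroʳ _ ⟩
    0#               ∎)

  *-cancelˡ-≤ : ∀ {a b c} → 0# < c → c * a ≤ c * b → a ≤ b
  *-cancelˡ-≤ {a} {b} {c} 0<c ca≤cb with a ≤? b
  ... | yes a≤b = a≤b
  ... | no  a≰b = ⊥-elim (<⇒≱ (<-from-difference (*-pos 0<c (difference-pos (≰⇒> a≰b)))
    (solve 3 (λ a b c → c :* a := c :* b :+ c :* (a :- b)) refl a b c)) ca≤cb)

  *-cancelˡ-≈ : ∀ {a b c} → 0# < c → c * a ≈ c * b → a ≈ b
  *-cancelˡ-≈ 0<c ca≈cb = antisym (*-cancelˡ-≤ 0<c (≤-reflexive ca≈cb))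
    (*-cancelˡ-≤ 0<c (≤-reflexive (sym ca≈cb)))

  *-monoˡ-< : ∀ {a b c} → 0# < c → a < b → c * a < c * b
  *-monoˡ-< 0<c a<b = ≰⇒> (λ cb≤ca → <⇒≱ a<b (*-cancelˡ-≤ 0<c cb≤ca))

  ⁻¹-pos : ∀ {a} → 0# < a → 0# < a ⁻¹
  ⁻¹-pos {a} 0<a = ≰⇒> λ a⁻¹≤0 → <⇒≱ 0<1 (≤-trans
    (≤-reflexive (sym (*-inverseʳ a (pos⇒≉0 0<a))))
      (≤-trans (*-monoˡ-≤ (proj₁ 0<a) a⁻¹≤0) (≤-reflexive (zeroʳ a))))

  fromℕ-nonNeg : ∀ n → 0# ≤ fromℕ n
  fromℕ-nonNeg zero    = ≤-refl
  fromℕ-nonNeg (suc n) = +-nonNeg (proj₁ 0<1) (fromℕ-nonNeg n)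

  fromℕ-mono-≤ : ∀ {m n} → m ℕ.≤ n → fromℕ m ≤ fromℕ n
  fromℕ-mono-≤ {n = n} ℕ.z≤n = fromℕ-nonNeg n
  fromℕ-mono-≤ (ℕ.s≤s m≤n)   = +-mono-≤ ≤-refl (fromℕ-mono-≤ m≤n)

  fromℕ-mono-< : ∀ {m n} → m ℕ.< n → fromℕ m < fromℕ n
  fromℕ-mono-< {m} m<n = <-≤-trans (<-from-difference 0<1 (+-comm 1# (fromℕ m))) (fromℕ-mono-≤ m<n)

  fromℕ-cancel-< : ∀ {m n} → fromℕ m < fromℕ n → m ℕ.< n
  fromℕ-cancel-< m<n = ℕₚ.≰⇒> (λ n≤m → <⇒≱ m<n (fromℕ-mono-≤ n≤m))

  fromℕ-pos : ∀ n → 0# < fromℕ (suc n)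
  fromℕ-pos n = fromℕ-mono-< {0} {suc n} (ℕ.s≤s ℕ.z≤n)

-- Binomial coefficients of a real argument

module Binomial {c ℓ} (F : CompleteOrderedField c ℓ) where
  open OrderedField F
  open import Relation.Binary.Reasoning.Setoid setoid

  private
    ff : ℝ → ℕ → ℝ
    ff = fallingFactorial

  factorial-pos : ∀ k → 0# < fromℕ (k !)
  factorial-pos k = fromℕ-mono-< {0} (ℕₚ.1≤n! k)

  fallingFactorial-cong : ∀ {y z} k → y ≈ z → ff y k ≈ ff z k
  fallingFactorial-cong zero    y≈z = refl
  fallingFactorial-cong (suc k) y≈z = *-cong (fallingFactorial-cong k y≈z) (+-congʳ y≈z)

  binom-cong : ∀ {y z} k → y ≈ z → binom y k ≈ binom z k
  binom-cong k y≈z = *-congʳ (fallingFactorial-cong k y≈z)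

  binom-zero : ∀ y → binom y 0 ≈ 1#
  binom-zero y = trans (*-congʳ (sym (+-identityʳ 1#))) (*-inverseʳ _ (pos⇒≉0 (factorial-pos 0)))

  binom-suc : ∀ y k → fromℕ (suc k) * binom y (suc k) ≈ binom y k * (y - fromℕ k)
  binom-suc y k = begin
    N * (ff y k * (y - K) * I)
      ≈⟨ solve 4 (λ N f z I → N :* (f :* z :* I) := con (+ 1) :* (f :* z :* (N :* I))) refl N
        (ff y k) (y - K) I ⟩
    1# * (ff y k * (y - K) * (N * I))
      -- The unit `M * M ⁻¹` supplies the inverse of `k !` on the right-hand side and the factor
      -- that completes `N` to `suc k !`.
      ≈⟨ *-congʳ (sym (*-inverseʳ M (pos⇒≉0 (factorial-pos k)))) ⟩
    (M * M ⁻¹) * (ff y k * (y - K) * (N * I))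
      ≈⟨ solve 6 (λ M J f z N I → (M :* J) :* (f :* z :* (N :* I)) :=
        (f :* J :* z) :* ((N :* M) :* I)) refl M (M ⁻¹) (ff y k) (y - K) N I ⟩
    (ff y k * M ⁻¹ * (y - K)) * ((N * M) * I)
      ≈⟨ *-congˡ (trans (*-congʳ (sym (fromℕ-* (suc k) (k !))))
        (*-inverseʳ _ (pos⇒≉0 (factorial-pos (suc k))))) ⟩
    (ff y k * M ⁻¹ * (y - K)) * 1#
      ≈⟨ *-identityʳ _ ⟩
    binom y k * (y - K) ∎
    where
    N = fromℕ (suc k)
    K = fromℕ k
    M = fromℕ (k !)
    I = fromℕ (suc k !) ⁻¹

  binom-absorption : ∀ y k → fromℕ (suc k) * binom y (suc k) ≈ y * binom (y - 1#) k
  binom-absorption y zero = begin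
    fromℕ 1 * binom y 1       ≈⟨ binom-suc y 0 ⟩
    binom y 0 * (y - 0#)      ≈⟨ *-congʳ (trans (binom-zero y) (sym (binom-zero (y - 1#)))) ⟩
    binom (y - 1#) 0 * (y - 0#)
      ≈⟨ solve 2 (λ b y → b :* (y :- con (+ 0)) := y :* b) refl (binom (y - 1#) 0) y ⟩
    y * binom (y - 1#) 0      ∎
  -- After multiplying by `suc k`, `binom-suc` applies at `y` on one side and at `y - 1#` on the
  -- other, with the induction hypothesis in between.
  binom-absorption y (suc k) = *-cancelˡ-≈ (fromℕ-pos k) (begin
    N * (fromℕ (suc (suc k)) * binom y (suc (suc k)))
      ≈⟨ *-congˡ (binom-suc y (suc k)) ⟩
    N * (binom y (suc k) * (y - N))
      ≈⟨ sym (*-assoc _ _ _) ⟩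
    N * binom y (suc k) * (y - N)
      ≈⟨ *-congʳ (binom-absorption y k) ⟩
    y * binom (y - 1#) k * (y - N)
      ≈⟨ solve 3 (λ y b k → y :* b :* (y :- (con (+ 1) :+ k)) :=
        y :* (b :* ((y :- con (+ 1)) :- k))) refl y (binom (y - 1#) k) (fromℕ k) ⟩
    y * (binom (y - 1#) k * ((y - 1#) - fromℕ k))
      ≈⟨ *-congˡ (sym (binom-suc (y - 1#) k)) ⟩
    y * (N * binom (y - 1#) (suc k))
      ≈⟨ solve 3 (λ y n b → y :* (n :* b) := n :* (y :* b)) refl y N (binom (y - 1#) (suc k)) ⟩
    N * (y * binom (y - 1#) (suc k)) ∎)
    where N = fromℕ (suc k)

  pred-< : ∀ k {y} → fromℕ (suc k) < y + 1# → fromℕ k < y + 1#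
  pred-< k = ≤-<-trans (fromℕ-mono-≤ (ℕₚ.n≤1+n k))

  pred-≤ : ∀ k {y} → fromℕ (suc k) ≤ y + 1# → fromℕ k ≤ y + 1#
  pred-≤ k = ≤-trans (fromℕ-mono-≤ (ℕₚ.n≤1+n k))

  factor-nonNeg : ∀ k {y} → fromℕ (suc k) ≤ y + 1# → 0# ≤ y - fromℕ k
  factor-nonNeg k {y} k<y+1 = ≤-trans (difference-nonNeg k<y+1)
    (≤-reflexive (solve 2 (λ y k → (y :+ con (+ 1)) :- (con (+ 1) :+ k) := y :- k) refl y
      (fromℕ k)))

  factor-pos : ∀ k {y} → fromℕ (suc k) < y + 1# → 0# < y - fromℕ k
  factor-pos k {y} k<y+1 = <-≤-trans (difference-pos k<y+1)
    (≤-reflexive (solve 2 (λ y k → (y :+ con (+ 1)) :- (con (+ 1) :+ k) := y :- k) refl y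
      (fromℕ k)))

  -- The smallest factor is `y - (k - 1)`, so the hypothesis makes every factor nonnegative; writing
  -- it with `y + 1#` avoids a predecessor of `k`.
  fallingFactorial-nonNeg : ∀ k {y} → fromℕ k ≤ y + 1# → 0# ≤ ff y k
  fallingFactorial-nonNeg zero    k≤y+1 = proj₁ 0<1
  fallingFactorial-nonNeg (suc k) k<y+1 = *-nonNeg (fallingFactorial-nonNeg k (pred-≤ k k<y+1))
    (factor-nonNeg k k<y+1)

  fallingFactorial-pos : ∀ k {y} → fromℕ k < y + 1# → 0# < ff y k
  fallingFactorial-pos zero    k<y+1 = 0<1
  fallingFactorial-pos (suc k) k<y+1 = *-pos (fallingFactorial-pos k (pred-< k k<y+1))
    (factor-pos k k<y+1)

  binom-nonNeg : ∀ k {y} → fromℕ k ≤ y + 1# → 0# ≤ binom y k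
  binom-nonNeg k k≤y+1 = *-nonNeg (fallingFactorial-nonNeg k k≤y+1)
    (proj₁ (⁻¹-pos (factorial-pos k)))

  binom-pos : ∀ k {y} → fromℕ k < y + 1# → 0# < binom y k
  binom-pos k k<y+1 = *-pos (fallingFactorial-pos k k<y+1) (⁻¹-pos (factorial-pos k))

  module _ {p t w : ℝ} (0≤t : 0# ≤ t) (t≤1 : t ≤ 1#) (0≤w : 0# ≤ w) where

    -- Bernoulli: each factor satisfies p - t w - i ≥ (1 - t) (p - i), as w ≤ p - i.
    fallingFactorial-shrink : ∀ k → fromℕ k + w ≤ p + 1# → (1# - fromℕ k * t) * ff p k ≤ ff
      (p - t * w) k
    fallingFactorial-shrink zero    _ = ≤-reflexive
      (solve 1 (λ t → (con (+ 1) :- con (+ 0) :* t) :* con (+ 1) := con (+ 1)) refl t)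
    fallingFactorial-shrink (suc k) k+1+w≤p+1 = ≤-trans step₁ (≤-trans step₂ step₃)
      where
      K f f′ : ℝ
      K = fromℕ k
      f = ff p k
      f′ = ff (p - t * w) k
      w≤p-K : w ≤ p - K
      w≤p-K = ≤-from-difference (difference-nonNeg k+1+w≤p+1)
        (solve 3 (λ w p k → p :- k := w :+ ((p :+ con (+ 1)) :- (con (+ 1) :+ k :+ w))) refl w p K)
      k+w≤p+1 : K + w ≤ p + 1#
      k+w≤p+1 = ≤-trans (+-monoˡ-≤ w (fromℕ-mono-≤ (ℕₚ.n≤1+n k))) k+1+w≤p+1
      0≤f : 0# ≤ f
      0≤f = fallingFactorial-nonNeg k (≤-trans (≤-from-difference 0≤w refl) k+w≤p+1)
      0≤p-K : 0# ≤ p - K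
      0≤p-K = ≤-trans 0≤w w≤p-K
      0≤f′ : 0# ≤ f′
      0≤f′ = fallingFactorial-nonNeg k (≤-from-difference
        (+-nonNeg (*-nonNeg (difference-nonNeg t≤1) 0≤w) (difference-nonNeg k+w≤p+1))
        (solve 4 (λ p t w k → (p :- t :* w) :+ con (+ 1) := k
          :+ ((con (+ 1) :- t) :* w :+ ((p :+ con (+ 1)) :- (k :+ w)))) refl p t w K))
      -- `(1 - K t) (1 - t)` exceeds `1 - (K + 1) t` by `K t²`.
      step₁ : (1# - fromℕ (suc k) * t) * (f * (p - K)) ≤ (1# - K * t) * f * ((1# - t) * (p - K))
      step₁ = ≤-from-difference
        (*-nonNeg (*-nonNeg (*-nonNeg (fromℕ-nonNeg k) (square-nonNeg t)) 0≤f) 0≤p-K)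
        (solve 4 (λ k t f z → (con (+ 1) :- k :* t) :* f :* ((con (+ 1) :- t) :* z)
          := (con (+ 1) :- (con (+ 1) :+ k) :* t) :* (f :* z) :+ k :* (t :* t) :* f :* z) refl K t f
            (p - K))
      step₂ : (1# - K * t) * f * ((1# - t) * (p - K)) ≤ f′ * ((1# - t) * (p - K))
      step₂ = *-monoʳ-≤ (*-nonNeg (difference-nonNeg t≤1) 0≤p-K) (fallingFactorial-shrink k k+w≤p+1)
      step₃ : f′ * ((1# - t) * (p - K)) ≤ f′ * ((p - t * w) - K)
      step₃ = *-monoˡ-≤ 0≤f′ (≤-from-difference (*-nonNeg 0≤t (difference-nonNeg w≤p-K))
        (solve 4 (λ p t w k → (p :- t :* w) :- k :=
          (con (+ 1) :- t) :* (p :- k) :+ t :* ((p :- k) :- w)) refl p t w K))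

    binom-shrink : ∀ k → fromℕ k + w ≤ p + 1# → (1# - fromℕ k * t) * binom p k ≤ binom (p - t * w) k
    binom-shrink k k+w≤p+1 = ≤-trans (≤-reflexive (sym (*-assoc _ _ _)))
      (*-monoʳ-≤ (proj₁ (⁻¹-pos (factorial-pos k))) (fallingFactorial-shrink k k+w≤p+1))

  module _ {x u : ℝ} (0≤x : 0# ≤ x) (0≤u : 0# ≤ u) where

    -- Since `(1 - u) x - i ≤ (1 - u) (x - i)`, scaling gains at least a factor `(1 - u)^k`, and
    -- this is at most `1 - k u / 2` while `k u ≤ 1`. The 2 clears the denominator.
    fallingFactorial-scale : ∀ k → fromℕ k ≤ (1# - u) * x + 1# → fromℕ k * u ≤ 1# →
      fromℕ 2 * ff ((1# - u) * x) k ≤ (fromℕ 2 - fromℕ k * u) * ff x k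
    fallingFactorial-scale zero _ _ = ≤-reflexive
      (solve 1 (λ u → con (+ 2) :* con (+ 1) := (con (+ 2) :- con (+ 0) :* u) :* con (+ 1)) refl u)
    fallingFactorial-scale (suc k) k<z+1 ku+u≤1 = ≤-trans step₁ (≤-trans step₂ step₃)
      where
      K f f′ : ℝ
      K = fromℕ k
      f = ff x k
      f′ = ff ((1# - u) * x) k
      0≤z-K : 0# ≤ (1# - u) * x - K
      0≤z-K = factor-nonNeg k k<z+1
      z-K≤ : (1# - u) * x - K ≤ (1# - u) * (x - K)
      z-K≤ = ≤-from-difference (*-nonNeg 0≤u (fromℕ-nonNeg k))
        (solve 3 (λ u x k → (con (+ 1) :- u) :* (x :- k) := (con (+ 1) :- u) :* x :- k :+ u :* k)
          refl u x K)
      0≤z′ : 0# ≤ (1# - u) * (x - K)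
      0≤z′ = ≤-trans 0≤z-K z-K≤
      0≤f′ : 0# ≤ fromℕ 2 * f′
      0≤f′ = *-nonNeg (fromℕ-nonNeg 2) (fallingFactorial-nonNeg k (pred-≤ k k<z+1))
      ku≤1 : K * u ≤ 1#
      ku≤1 = ≤-trans (*-monoʳ-≤ 0≤u (fromℕ-mono-≤ (ℕₚ.n≤1+n k))) ku+u≤1
      0≤f : 0# ≤ f
      0≤f = fallingFactorial-nonNeg k
        (≤-trans (pred-≤ k k<z+1) (+-monoˡ-≤ 1# (≤-from-difference (*-nonNeg 0≤u 0≤x)
        (solve 2 (λ u x → x := (con (+ 1) :- u) :* x :+ u :* x) refl u x))))
      0≤x-K : 0# ≤ x - K
      0≤x-K = ≤-trans 0≤z-K (≤-from-difference (*-nonNeg 0≤u 0≤x)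
        (solve 3 (λ u x k → x :- k := (con (+ 1) :- u) :* x :- k :+ u :* x) refl u x K))
      step₁ : fromℕ 2 * (f′ * ((1# - u) * x - K)) ≤ fromℕ 2 * f′ * ((1# - u) * (x - K))
      step₁ = ≤-trans (≤-reflexive (sym (*-assoc _ _ _))) (*-monoˡ-≤ 0≤f′ z-K≤)
      step₂ : fromℕ 2 * f′ * ((1# - u) * (x - K)) ≤ (fromℕ 2 - K * u) * f * ((1# - u) * (x - K))
      step₂ = *-monoʳ-≤ 0≤z′ (fallingFactorial-scale k (pred-≤ k k<z+1) ku≤1)
      -- `2 - (K + 1) u` exceeds `(2 - K u) (1 - u)` by `u (1 - K u)`, which is nonnegative by
      -- `ku≤1`.
      step₃ : (fromℕ 2 - K * u) * f * ((1# - u) * (x - K)) ≤ (fromℕ 2 - fromℕ (suc k) * u) *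
        (f * (x - K))
      step₃ = ≤-from-difference
        (*-nonNeg (*-nonNeg (*-nonNeg 0≤u (difference-nonNeg ku≤1)) 0≤f) 0≤x-K)
        (solve 4 (λ k u f z → (con (+ 2) :- (con (+ 1) :+ k) :* u) :* (f :* z)
          := (con (+ 2) :- k :* u) :* f :* ((con (+ 1) :- u) :* z)
            :+ u :* (con (+ 1) :- k :* u) :* f :* z) refl K u f (x - K))

    binom-scale : ∀ k → fromℕ k ≤ (1# - u) * x + 1# → fromℕ k * u ≤ 1# →
      fromℕ 2 * binom ((1# - u) * x) k ≤ (fromℕ 2 - fromℕ k * u) * binom x k
    binom-scale k k≤z+1 ku≤1 = ≤-trans (≤-reflexive (sym (*-assoc _ _ _))) (≤-trans
      (*-monoʳ-≤ (proj₁ (⁻¹-pos (factorial-pos k))) (fallingFactorial-scale k k≤z+1 ku≤1))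
        (≤-reflexive (*-assoc _ _ _)))

  fallingFactorial-vanish : ∀ {n k} → n ℕ.< k → ff (fromℕ n) k ≈ 0#
  fallingFactorial-vanish {n} {suc k} (ℕ.s≤s n≤k) with ℕₚ.m≤n⇒m<n∨m≡n n≤k
  ... | inj₁ n<k    = trans (*-congʳ (fallingFactorial-vanish n<k)) (zeroˡ _)
  ... | inj₂ ≡.refl = trans (*-congˡ (-‿inverseʳ (fromℕ n))) (zeroʳ _)

  module _ {n : ℕ} {x : ℝ} (n<x : fromℕ n < x) where

    -- If `n` is less than the number of factors, one of them is zero and the left side vanishes;
    -- otherwise all are positive and can be compared one by one. The integer `n` will be the order
    -- of the graph.
    fallingFactorial-mono-≤ : ∀ k → fromℕ k ≤ x + 1# → ff (fromℕ n) k ≤ ff x k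
    fallingFactorial-mono-≤ zero    _ = ≤-refl
    fallingFactorial-mono-≤ (suc k) k<x+1 with suc n ℕₚ.≤? suc k
    ... | yes n<k+1 = ≤-trans (≤-reflexive (fallingFactorial-vanish n<k+1))
      (fallingFactorial-nonNeg (suc k) k<x+1)
    ... | no  n≮k+1 = *-mono-≤
            (difference-nonNeg (fromℕ-mono-≤ (ℕₚ.≤-trans (ℕₚ.n≤1+n k) (ℕ.s≤s⁻¹ (ℕₚ.≰⇒> n≮k+1)))))
            (fallingFactorial-nonNeg k (pred-≤ k k<x+1))
            (fallingFactorial-mono-≤ k (pred-≤ k k<x+1)) (+-monoˡ-≤ (- fromℕ k) (proj₁ n<x))

    fallingFactorial-mono-< : ∀ k → fromℕ (suc k) < x + 1# → ff (fromℕ n) (suc k) < ff x (suc k)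
    fallingFactorial-mono-< k k<x+1 with suc n ℕₚ.≤? suc k
    ... | yes n<k+1 = ≤-<-trans (≤-reflexive (fallingFactorial-vanish n<k+1))
      (fallingFactorial-pos (suc k) k<x+1)
    ... | no  n≮k+1 = ≤-<-trans (*-monoʳ-≤
            (difference-nonNeg (fromℕ-mono-≤ (ℕₚ.≤-trans (ℕₚ.n≤1+n k) (ℕ.s≤s⁻¹ (ℕₚ.≰⇒> n≮k+1)))))
            (fallingFactorial-mono-≤ k (proj₁ (pred-< k k<x+1))))
            (*-monoˡ-< (fallingFactorial-pos k (pred-< k k<x+1))
              (<-from-difference (difference-pos n<x)
              (solve 3 (λ x n k → x :- k := n :- k :+ (x :- n)) refl x (fromℕ n) (fromℕ k))))

    binom-mono-< : ∀ k → fromℕ (suc k) < x + 1# → binom (fromℕ n) (suc k) < binom x (suc k)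
    binom-mono-< k k<x+1 = ≤-<-trans (≤-reflexive (*-comm _ _)) (<-≤-trans
      (*-monoˡ-< (⁻¹-pos (factorial-pos (suc k))) (fallingFactorial-mono-< k k<x+1))
        (≤-reflexive (*-comm _ _)))

  -- Absorption turns the left side into `(n + 1) binom n k`, and `n + 1 = (n - k) + (k + 1)` splits
  -- it.
  binom-pascal : ∀ n k → binom (fromℕ (suc n)) (suc k) ≈ binom (fromℕ n) (suc k) + binom (fromℕ n) k
  binom-pascal n k = *-cancelˡ-≈ (fromℕ-pos k) (begin
    N * binom (fromℕ (suc n)) (suc k)                       ≈⟨ binom-absorption (fromℕ (suc n)) k ⟩
    fromℕ (suc n) * binom (fromℕ (suc n) - 1#) k
      ≈⟨ *-congˡ (binom-cong k (solve 1 (λ n → (con (+ 1) :+ n) :- con (+ 1) := n) refl (fromℕ n)))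
        ⟩
    fromℕ (suc n) * b
      ≈⟨ solve 3 (λ n k b → (con (+ 1) :+ n) :* b := b :* (n :- k) :+ (con (+ 1) :+ k) :* b) refl
        (fromℕ n) (fromℕ k) b ⟩
    b * (fromℕ n - fromℕ k) + N * b
      ≈⟨ +-congʳ (sym (binom-suc (fromℕ n) k)) ⟩
    N * binom (fromℕ n) (suc k) + N * b
      ≈⟨ solve 3 (λ n a b → n :* a :+ n :* b := n :* (a :+ b)) refl N (binom (fromℕ n) (suc k)) b ⟩
    N * (binom (fromℕ n) (suc k) + b)                       ∎)
    where
    N = fromℕ (suc k)
    b = binom (fromℕ n) k

  binom-zero-suc : ∀ k → binom (fromℕ 0) (suc k) ≈ 0#
  binom-zero-suc k = trans (*-congʳ (fallingFactorial-vanish {0} {suc k} (ℕ.s≤s ℕ.z≤n))) (zeroˡ _)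

-- Sums over subsets

private
  variable
    ℓ₁ ℓ₂ : Level
    X : Set ℓ₁
    Y : Set ℓ₂
    n : ℕ

indicator : Dec X → ℕ
indicator a? = if does a? then 1 else 0

indicator-yes : (a? : Dec X) → X → indicator a? ≡ 1
indicator-yes a? x = cong (if_then 1 else 0) (dec-true a? x)

indicator-no : (a? : Dec X) → ¬ X → indicator a? ≡ 0
indicator-no a? ¬x = cong (if_then 1 else 0) (dec-false a? ¬x)

indicator-mono : (a? : Dec X) (b? : Dec Y) → (X → Y) → indicator a? ℕ.≤ indicator b?
indicator-mono a? b? X→Y with a?
... | yes x = ℕₚ.≤-reflexive (≡.sym (indicator-yes b? (X→Y x)))
... | no  _ = z≤n

indicator-cong : (a? : Dec X) (b? : Dec Y) → (X → Y) → (Y → X) → indicator a? ≡ indicator b?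
indicator-cong a? b? X→Y Y→X = ℕₚ.≤-antisym (indicator-mono a? b? X→Y) (indicator-mono b? a? Y→X)

indicator-split : (a? : Dec X) (b? : Dec Y) →
  indicator a? ≡ indicator (a? ×-dec b?) ℕ.+ indicator (a? ×-dec ¬? b?)
indicator-split (no _)  b?      = ≡.refl
indicator-split (yes _) (yes _) = ≡.refl
indicator-split (yes _) (no _)  = ≡.refl

sum-mono : (f g : Fin n → ℕ) → (∀ i → f i ℕ.≤ g i) → sum f ℕ.≤ sum g
sum-mono {zero}  f g f≤g = z≤n
sum-mono {suc n} f g f≤g = ℕₚ.+-mono-≤ (f≤g zero) (sum-mono (f ∘ suc) (g ∘ suc) (f≤g ∘ suc))

term≤sum : (f : Fin n → ℕ) (i : Fin n) → f i ℕ.≤ sum f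
term≤sum f zero    = ℕₚ.m≤m+n _ _
term≤sum f (suc i) = ℕₚ.≤-trans (term≤sum (f ∘ suc) i) (ℕₚ.m≤n+m _ _)

-- Recursion on the ground set instead of the list `subsets n`: exchanging sums and reindexing by a
-- bijection become inductions on `n`.
sumS : (Subset n → ℕ) → ℕ
sumS {zero}  f = f Vec.[]
sumS {suc n} f = sumS (f ∘ (outside Vec.∷_)) ℕ.+ sumS (f ∘ (inside Vec.∷_))

sumS-cong : {f g : Subset n → ℕ} → (∀ S → f S ≡ g S) → sumS f ≡ sumS g
sumS-cong {zero}  f≡g = f≡g Vec.[]
sumS-cong {suc n} f≡g = cong₂ ℕ._+_ (sumS-cong {n} (f≡g ∘ (outside Vec.∷_)))
  (sumS-cong {n} (f≡g ∘ (inside Vec.∷_)))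

sumS-mono : {f g : Subset n → ℕ} → (∀ S → f S ℕ.≤ g S) → sumS f ℕ.≤ sumS g
sumS-mono {zero}  f≤g = f≤g Vec.[]
sumS-mono {suc n} f≤g = ℕₚ.+-mono-≤ (sumS-mono {n} (f≤g ∘ (outside Vec.∷_)))
  (sumS-mono {n} (f≤g ∘ (inside Vec.∷_)))

term≤sumS : (f : Subset n → ℕ) (S : Subset n) → f S ℕ.≤ sumS f
term≤sumS f Vec.[]              = ℕₚ.≤-refl
term≤sumS f (outside Vec.∷ S) = ℕₚ.≤-trans (term≤sumS (f ∘ (outside Vec.∷_)) S) (ℕₚ.m≤m+n _ _)
term≤sumS f (inside  Vec.∷ S) = ℕₚ.≤-trans (term≤sumS (f ∘ (inside Vec.∷_)) S) (ℕₚ.m≤n+m _ _)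

sumS-+ : (f g : Subset n → ℕ) → sumS (λ S → f S ℕ.+ g S) ≡ sumS f ℕ.+ sumS g
sumS-+ {zero}  f g = ≡.refl
sumS-+ {suc n} f g = ≡.trans
  (cong₂ ℕ._+_ (sumS-+ (f ∘ (outside Vec.∷_)) (g ∘ (outside Vec.∷_)))
    (sumS-+ (f ∘ (inside Vec.∷_)) (g ∘ (inside Vec.∷_))))
  (interchange (sumS (f ∘ (outside Vec.∷_))) _ _ _)

sumS-* : ∀ c (f : Subset n → ℕ) → sumS (λ S → c ℕ.* f S) ≡ c ℕ.* sumS f
sumS-* {zero}  c f = ≡.refl
sumS-* {suc n} c f = ≡.trans (cong₂ ℕ._+_ (sumS-* {n} c _) (sumS-* {n} c _))
  (≡.sym (ℕₚ.*-distribˡ-+ c _ _))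

sumS-zero : sumS {n} (λ _ → 0) ≡ 0
sumS-zero {zero}  = ≡.refl
sumS-zero {suc n} = cong₂ ℕ._+_ (sumS-zero {n}) (sumS-zero {n})

sum-sumS-comm : ∀ {n k} (f : Fin k → Subset n → ℕ) → sum (λ v → sumS (f v)) ≡ sumS
  (λ S → sum (λ v → f v S))
sum-sumS-comm {zero}  f = ≡.refl
sum-sumS-comm {suc n} f = ≡.trans
  (∑-distrib-+ (λ v → sumS (f v ∘ (outside Vec.∷_))) (λ v → sumS (f v ∘ (inside Vec.∷_))))
  (cong₂ ℕ._+_ (sum-sumS-comm {n} (λ v → f v ∘ (outside Vec.∷_)))
    (sum-sumS-comm {n} (λ v → f v ∘ (inside Vec.∷_))))

length-filter-map : {P : Pred Y ℓ₂} (P? : Decidable P) (f : X → Y) (xs : List X) →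
  length (filter P? (List.map f xs)) ≡ length (filter (P? ∘ f) xs)
length-filter-map P? f []       = ≡.refl
length-filter-map P? f (x ∷ xs) with does (P? (f x))
... | true  = cong suc (length-filter-map P? f xs)
... | false = length-filter-map P? f xs

#subsets≡sumS : {P : Pred (Subset n) ℓ₁} (P? : Decidable P) → #subsets P? ≡ sumS (indicator ∘ P?)
#subsets≡sumS {zero} P? with does (P? Vec.[])
... | true  = ≡.refl
... | false = ≡.refl
#subsets≡sumS {suc n} P? = ≡.trans
  (cong length (Listₚ.filter-++ P? (List.map (outside Vec.∷_) (subsets n)) _))
  (≡.trans (Listₚ.length-++ (filter P? (List.map (outside Vec.∷_) (subsets n))))
  (cong₂ ℕ._+_ (≡.trans (length-filter-map P? _ (subsets n))
    (#subsets≡sumS (P? ∘ (outside Vec.∷_))))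
               (≡.trans (length-filter-map P? _ (subsets n))
                 (#subsets≡sumS (P? ∘ (inside Vec.∷_))))))

length-filter-tabulate : {P : Pred X ℓ₂} (P? : Decidable P) (f : Fin n → X) →
  length (filter P? (tabulate f)) ≡ sum (indicator ∘ P? ∘ f)
length-filter-tabulate {n = zero}  P? f = ≡.refl
length-filter-tabulate {n = suc n} P? f with does (P? (f zero))
... | true  = cong suc (length-filter-tabulate P? (f ∘ suc))
... | false = length-filter-tabulate P? (f ∘ suc)

#vertices≡sum : {P : Pred (Fin n) ℓ₁} (P? : Decidable P) → #vertices P? ≡ sum (indicator ∘ P?)
#vertices≡sum P? = length-filter-tabulate P? id

∣S∣≡sum : (S : Subset n) → ∣ S ∣ ≡ sum (λ v → indicator (v ∈? S))
∣S∣≡sum Vec.[]            = ≡.refl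
∣S∣≡sum (outside Vec.∷ S) = ∣S∣≡sum S
∣S∣≡sum (inside  Vec.∷ S) = cong suc (∣S∣≡sum S)

module _ {P : Pred (Subset n) ℓ₁} {Q : Pred (Subset n) ℓ₂} (P? : Decidable P)
  (Q? : Decidable Q) where

  #subsets-mono : (∀ S → P S → Q S) → #subsets P? ℕ.≤ #subsets Q?
  #subsets-mono P⊆Q = ≡.subst₂ ℕ._≤_ (≡.sym (#subsets≡sumS P?)) (≡.sym (#subsets≡sumS Q?))
    (sumS-mono (λ S → indicator-mono (P? S) (Q? S) (P⊆Q S)))

  #subsets-split : #subsets P? ≡ #subsets (λ S → P? S ×-dec Q? S) ℕ.+ #subsets
    (λ S → P? S ×-dec ¬? (Q? S))
  #subsets-split = ≡.trans (#subsets≡sumS P?)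
    (≡.trans (sumS-cong (λ S → indicator-split (P? S) (Q? S)))
    (≡.trans (sumS-+ {n} _ _) (≡.sym
      (cong₂ ℕ._+_ (#subsets≡sumS (λ S → P? S ×-dec Q? S))
        (#subsets≡sumS (λ S → P? S ×-dec ¬? (Q? S)))))))

  -- Union bound: each set counted on the left is charged to one of its witnesses `v`.
  #subsets-cover : ∀ {r} {R : Pred (Fin n) r} (R? : Decidable R) →
    (∀ S → P S → ∃[ v ] R v × Q S × v ∈ S) →
    #subsets P? ℕ.≤ sum (λ v → indicator (R? v) ℕ.* #subsets (λ S → Q? S ×-dec v ∈? S))
  #subsets-cover R? cover = begin
    #subsets P?                                                       ≡⟨ #subsets≡sumS P? ⟩
    sumS (indicator ∘ P?)                                             ≤⟨ sumS-mono pointwise ⟩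
    sumS (λ S → sum (λ v → indicator (R? v) ℕ.* indicator (Q? S ×-dec v ∈? S)))
      ≡⟨ sum-sumS-comm {n} (λ v S → indicator (R? v) ℕ.* indicator (Q? S ×-dec v ∈? S)) ⟨
    sum (λ v → sumS (λ S → indicator (R? v) ℕ.* indicator (Q? S ×-dec v ∈? S)))
      ≡⟨ sum-cong-≗ (λ v → ≡.trans (sumS-* {n} (indicator (R? v)) _)
        (cong (indicator (R? v) ℕ.*_) (≡.sym (#subsets≡sumS (λ S → Q? S ×-dec v ∈? S))))) ⟩
    sum (λ v → indicator (R? v) ℕ.* #subsets (λ S → Q? S ×-dec v ∈? S)) ∎
    where
    open ℕₚ.≤-Reasoning
    pointwise : ∀ S → indicator (P? S) ℕ.≤ sum
      (λ v → indicator (R? v) ℕ.* indicator (Q? S ×-dec v ∈? S))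
    pointwise S with P? S
    ... | no _  = z≤n
    ... | yes x with cover S x
    ... | v , Rv , QS , v∈S = ℕₚ.≤-trans
      (ℕₚ.≤-reflexive (≡.sym (cong₂ ℕ._*_ (indicator-yes (R? v) Rv)
        (indicator-yes (Q? S ×-dec v ∈? S) (QS , v∈S)))))
      (term≤sum (λ v → indicator (R? v) ℕ.* indicator (Q? S ×-dec v ∈? S)) v)

module _ {P : Pred (Subset n) ℓ₁} (P? : Decidable P) where

  -- Counts the pairs `v ∈ S` first by vertex, then by set.
  #subsets-double-count : ∀ k → (∀ {S} → P S → ∣ S ∣ ≡ k) →
    sum (λ v → #subsets (λ S → P? S ×-dec v ∈? S)) ≡ k ℕ.* #subsets P?
  #subsets-double-count k uniform = begin
    sum (λ v → #subsets (λ S → P? S ×-dec v ∈? S))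
      ≡⟨ sum-cong-≗ (λ v → #subsets≡sumS (λ S → P? S ×-dec v ∈? S)) ⟩
    sum (λ v → sumS (λ S → indicator (P? S ×-dec v ∈? S)))
      ≡⟨ sum-sumS-comm {n} (λ v S → indicator (P? S ×-dec v ∈? S)) ⟩
    sumS (λ S → sum (λ v → indicator (P? S ×-dec v ∈? S)))       ≡⟨ sumS-cong pointwise ⟩
    sumS (λ S → k ℕ.* indicator (P? S))                          ≡⟨ sumS-* {n} k _ ⟩
    k ℕ.* sumS (indicator ∘ P?)
      ≡⟨ cong (k ℕ.*_) (≡.sym (#subsets≡sumS P?)) ⟩
    k ℕ.* #subsets P?                                            ∎
    where
    open ≡.≡-Reasoning
    pointwise : ∀ S → sum (λ v → indicator (P? S ×-dec v ∈? S)) ≡ k ℕ.* indicator (P? S)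
    pointwise S with P? S
    ... | yes x = ≡.trans (≡.sym (∣S∣≡sum S)) (≡.trans (uniform x) (≡.sym (ℕₚ.*-identityʳ k)))
    ... | no  _ = ≡.trans (sum-replicate-zero n) (≡.sym (ℕₚ.*-zeroʳ k))

-- Adding and deleting a vertex

toggle : Fin n → Subset n → Subset n
toggle zero    (s Vec.∷ S) = not s Vec.∷ S
toggle (suc v) (s Vec.∷ S) = s Vec.∷ toggle v S

sumS-toggle : (v : Fin n) (f : Subset n → ℕ) → sumS (f ∘ toggle v) ≡ sumS f
sumS-toggle {suc n} zero    f = ℕₚ.+-comm (sumS (f ∘ (inside Vec.∷_))) _
sumS-toggle {suc n} (suc v) f = cong₂ ℕ._+_ (sumS-toggle {n} v _) (sumS-toggle {n} v _)

-- Toggling is an involution, so it preserves counts; it exchanges the sets through `v` with those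
-- avoiding `v`, which is how cliques through `v` are compared with edges and with the link.
#subsets-toggle : (v : Fin n) {P : Pred (Subset n) ℓ₁} (P? : Decidable P) → #subsets
  (P? ∘ toggle v) ≡ #subsets P?
#subsets-toggle v P? = ≡.trans (#subsets≡sumS (P? ∘ toggle v))
  (≡.trans (sumS-toggle v (indicator ∘ P?)) (≡.sym (#subsets≡sumS P?)))

toggle-involutive : (v : Fin n) (S : Subset n) → toggle v (toggle v S) ≡ S
toggle-involutive zero    (inside  Vec.∷ S) = ≡.refl
toggle-involutive zero    (outside Vec.∷ S) = ≡.refl
toggle-involutive (suc v) (s Vec.∷ S)       = cong (s Vec.∷_) (toggle-involutive v S)

∉⇒∈-toggle : (v : Fin n) (S : Subset n) → v ∉ S → v ∈ toggle v S
∉⇒∈-toggle zero    (inside  Vec.∷ S) v∉S = ⊥-elim (v∉S here)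
∉⇒∈-toggle zero    (outside Vec.∷ S) v∉S = here
∉⇒∈-toggle (suc v) (s Vec.∷ S)       v∉S = there (∉⇒∈-toggle v S (v∉S ∘ there))

∈⇒∉-toggle : (v : Fin n) (S : Subset n) → v ∈ S → v ∉ toggle v S
∈⇒∉-toggle zero    (inside Vec.∷ S) here        ()
∈⇒∉-toggle (suc v) (s Vec.∷ S)      (there v∈S) (there v∈S′) = ∈⇒∉-toggle v S v∈S v∈S′

∈-toggle⇒∉ : (v : Fin n) (S : Subset n) → v ∈ toggle v S → v ∉ S
∈-toggle⇒∉ v S v∈S′ v∈S = ∈⇒∉-toggle v S v∈S v∈S′

∈-toggle : (v : Fin n) (S : Subset n) {w : Fin n} → w ≢ v → w ∈ S → w ∈ toggle v S
∈-toggle zero    (s Vec.∷ S) {zero}  w≢v w∈S         = ⊥-elim (w≢v ≡.refl)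
∈-toggle zero    (s Vec.∷ S) {suc w} w≢v (there w∈S) = there w∈S
∈-toggle (suc v) (s Vec.∷ S) {zero}  w≢v here        = here
∈-toggle (suc v) (s Vec.∷ S) {suc w} w≢v (there w∈S) = there (∈-toggle v S (w≢v ∘ cong suc) w∈S)

toggle-∈ : (v : Fin n) (S : Subset n) {w : Fin n} → w ≢ v → w ∈ toggle v S → w ∈ S
toggle-∈ v S w≢v w∈S′ = ≡.subst (_ ∈_) (toggle-involutive v S) (∈-toggle v (toggle v S) w≢v w∈S′)

∣toggle∣-∉ : (v : Fin n) (S : Subset n) → v ∉ S → ∣ toggle v S ∣ ≡ suc ∣ S ∣
∣toggle∣-∉ zero    (inside  Vec.∷ S) v∉S = ⊥-elim (v∉S here)
∣toggle∣-∉ zero    (outside Vec.∷ S) v∉S = ≡.refl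
∣toggle∣-∉ (suc v) (inside  Vec.∷ S) v∉S = cong suc (∣toggle∣-∉ v S (v∉S ∘ there))
∣toggle∣-∉ (suc v) (outside Vec.∷ S) v∉S = ∣toggle∣-∉ v S (v∉S ∘ there)

∣toggle∣-∈ : (v : Fin n) (S : Subset n) → v ∈ S → suc ∣ toggle v S ∣ ≡ ∣ S ∣
∣toggle∣-∈ v S v∈S = ≡.trans (≡.sym (∣toggle∣-∉ v (toggle v S) (∈⇒∉-toggle v S v∈S)))
  (cong ∣_∣ (toggle-involutive v S))

⊆-toggle : (v : Fin n) (S : Subset n) → v ∉ S → S ⊆ toggle v S
⊆-toggle v S v∉S w∈S = ∈-toggle v S (λ { ≡.refl → v∉S w∈S }) w∈S

⊈⇒∃ : (S T : Subset n) → ¬ S ⊆ T → ∃[ v ] v ∈ S × v ∉ T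
⊈⇒∃ {n} S T S⊈T with Finₚ.¬∀⟶∃¬ n (λ v → v ∈ S → v ∈ T) (λ v → (v ∈? S) →-dec (v ∈? T))
  (λ ∀v → S⊈T (∀v _))
... | v , ¬v = v , decidable-stable (v ∈? S) (λ v∉S → ¬v (⊥-elim ∘ v∉S)) , λ v∈T → ¬v (λ _ → v∈T)

∣S∣<n⇒∃∉ : (S : Subset n) → ∣ S ∣ ℕ.< n → ∃[ v ] v ∉ S
∣S∣<n⇒∃∉ {n} S ∣S∣<n with ⊈⇒∃ ⊤ S
  (λ ⊤⊆S → ℕₚ.<⇒≱ ∣S∣<n (ℕₚ.≤-trans (ℕₚ.≤-reflexive (≡.sym (∣⊤∣≡n n))) (p⊆q⇒∣p∣≤∣q∣ ⊤⊆S)))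
... | v , _ , v∉S = v , v∉S

-- Adds missing vertices one at a time; this later pads a set up to `⌈x⌉`.
enlarge : ∀ m (S : Subset n) → m ℕ.+ ∣ S ∣ ℕ.≤ n → ∃[ T ] S ⊆ T × ∣ T ∣ ≡ m ℕ.+ ∣ S ∣
enlarge zero    S _ = S , id , ≡.refl
enlarge (suc m) S m+∣S∣<n with ∣S∣<n⇒∃∉ S (ℕₚ.≤-trans (s≤s (ℕₚ.m≤n+m ∣ S ∣ m)) m+∣S∣<n)
... | v , v∉S with enlarge m (toggle v S)
  (ℕₚ.≤-trans (ℕₚ.≤-reflexive (≡.trans (cong (m ℕ.+_) (∣toggle∣-∉ v S v∉S)) (ℕₚ.+-suc m ∣ S ∣)))
    m+∣S∣<n)
... | T , S′⊆T , ∣T∣≡ = T , S′⊆T ∘ ⊆-toggle v S v∉S ,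
  ≡.trans ∣T∣≡ (≡.trans (cong (m ℕ.+_) (∣toggle∣-∉ v S v∉S)) (ℕₚ.+-suc m ∣ S ∣))

-- The number of sets of a given size

#ofSize : ℕ → ℕ → ℕ
#ofSize n k = #subsets {n} (λ S → ∣ S ∣ ℕₚ.≟ k)

-- `sumS` splits by membership of the first element, which is exactly Pascal's rule.
#ofSize-pascal : ∀ n k → #ofSize (suc n) (suc k) ≡ #ofSize n (suc k) ℕ.+ #ofSize n k
#ofSize-pascal n k = ≡.trans (#subsets≡sumS (λ (S : Subset (suc n)) → ∣ S ∣ ℕₚ.≟ suc k))
  (≡.sym (cong₂ ℕ._+_
  (#subsets≡sumS (λ (S : Subset n) → ∣ S ∣ ℕₚ.≟ suc k))
  (≡.trans (#subsets≡sumS (λ (S : Subset n) → ∣ S ∣ ℕₚ.≟ k))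
    (sumS-cong (λ (S : Subset n) → indicator-cong (∣ S ∣ ℕₚ.≟ k) (suc ∣ S ∣ ℕₚ.≟ suc k)
      (cong suc) ℕₚ.suc-injective)))))

#ofSize-zero : ∀ n → #ofSize n 0 ≡ 1
#ofSize-zero zero    = ≡.refl
#ofSize-zero (suc n) = ≡.trans (#subsets≡sumS (λ (S : Subset (suc n)) → ∣ S ∣ ℕₚ.≟ 0)) (cong₂ ℕ._+_
  (≡.trans (≡.sym (#subsets≡sumS (λ (S : Subset n) → ∣ S ∣ ℕₚ.≟ 0))) (#ofSize-zero n))
  (sumS-zero {n}))

#subsets-empty : ∀ {n p} {P : Pred (Subset n) p} (P? : Decidable P) →
  (∀ S → ¬ P S) → #subsets P? ≡ 0
#subsets-empty {n} P? ¬P = ≡.trans (#subsets≡sumS P?)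
  (≡.trans (sumS-cong (λ S → indicator-no (P? S) (¬P S))) (sumS-zero {n}))

#subsets-nonempty : ∀ {n p} {P : Pred (Subset n) p} (P? : Decidable P) {S} → P S → 1 ℕ.≤ #subsets P?
#subsets-nonempty P? {S} x = ℕₚ.≤-trans (ℕₚ.≤-reflexive (≡.sym (indicator-yes (P? S) x)))
  (ℕₚ.≤-trans (term≤sumS (indicator ∘ P?) S) (ℕₚ.≤-reflexive (≡.sym (#subsets≡sumS P?))))

-- Degrees, cliques and links

module _ {r} (G : RGraph r) where
  open RGraph G

  cliqueDegree : V → ℕ
  cliqueDegree v = #subsets (λ T → IsClique? T ×-dec v ∈? T)

  degree-sum : sum degree ≡ r ℕ.* size
  degree-sum = #subsets-double-count Edge? r uniform

  cliqueDegree-sum : sum cliqueDegree ≡ suc r ℕ.* cliques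
  cliqueDegree-sum = #subsets-double-count IsClique? (suc r) proj₁

  clique-facet : ∀ v T → IsClique (toggle v T) → v ∈ toggle v T → Edge T
  clique-facet v T (∣T′∣≡ , edges) v∈T′ = edges T (⊆-toggle v T v∉T)
    (ℕₚ.suc-injective (≡.trans (≡.sym (∣toggle∣-∉ v T v∉T)) ∣T′∣≡))
    where
    v∉T : v ∉ T
    v∉T = ∈-toggle⇒∉ v T v∈T′

  -- Deleting `v` sends the cliques through `v` injectively to edges avoiding `v`, and those are the
  -- edges that `degree v` does not count.
  cliqueDegree+degree≤size : ∀ v → cliqueDegree v ℕ.+ degree v ℕ.≤ size
  cliqueDegree+degree≤size v = begin
    cliqueDegree v ℕ.+ degree v
      ≡⟨ cong (ℕ._+ degree v) (≡.sym (#subsets-toggle v (λ T → IsClique? T ×-dec v ∈? T))) ⟩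
    #subsets (λ T → IsClique? (toggle v T) ×-dec v ∈? toggle v T) ℕ.+ degree v
      ≤⟨ ℕₚ.+-monoˡ-≤ (degree v)
        (#subsets-mono (λ T → IsClique? (toggle v T) ×-dec v ∈? toggle v T)
          (λ T → Edge? T ×-dec ¬? (v ∈? T))
           (λ T (clique , v∈T′) → clique-facet v T clique v∈T′ , ∈-toggle⇒∉ v T v∈T′)) ⟩
    #subsets (λ T → Edge? T ×-dec ¬? (v ∈? T)) ℕ.+ degree v
      ≡⟨ ℕₚ.+-comm _ (degree v) ⟩
    degree v ℕ.+ #subsets (λ T → Edge? T ×-dec ¬? (v ∈? T))
      ≡⟨ #subsets-split Edge? (v ∈?_) ⟨
    size ∎
    where open ℕₚ.≤-Reasoning

  edgesIncidentTo≤ : ∀ {p} {P : Pred V p} (P? : Decidable P) →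
    edgesIncidentTo P? ℕ.≤ sum (λ v → indicator (P? v) ℕ.* degree v)
  edgesIncidentTo≤ P? = #subsets-cover
    (λ S → Edge? S ×-dec Finₚ.any? (λ v → P? v ×-dec v ∈? S)) Edge? P?
      (λ S (e , v , Pv , v∈S) → v , Pv , e , v∈S)

  edgesNotIn≤ : ∀ C → edgesNotIn C ℕ.≤ sum (λ v → indicator (¬? (v ∈? C)) ℕ.* degree v)
  edgesNotIn≤ C = #subsets-cover (λ S → Edge? S ×-dec ¬? (S ⊆? C)) Edge? (λ v → ¬? (v ∈? C)) cover
    where
    cover : ∀ S → Edge S × ¬ S ⊆ C → ∃[ v ] v ∉ C × Edge S × v ∈ S
    cover S (e , S⊈C) with ⊈⇒∃ S C S⊈C
    ... | v , v∈S , v∉C = v , v∉C , e , v∈S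

  cliques≤ : ∀ C → cliques ℕ.≤ cliquesIn C ℕ.+ sum
    (λ v → indicator (¬? (v ∈? C)) ℕ.* cliqueDegree v)
  cliques≤ C = ℕₚ.≤-trans (ℕₚ.≤-reflexive (#subsets-split IsClique? (_⊆? C)))
    (ℕₚ.+-monoʳ-≤ (cliquesIn C)
      (#subsets-cover (λ S → IsClique? S ×-dec ¬? (S ⊆? C)) IsClique? (λ v → ¬? (v ∈? C)) cover))
    where
    cover : ∀ S → IsClique S × ¬ S ⊆ C → ∃[ v ] v ∉ C × IsClique S × v ∈ S
    cover S (e , S⊈C) with ⊈⇒∃ S C S⊈C
    ... | v , v∈S , v∉C = v , v∉C , e , v∈S

  edgesNotIn-mono : ∀ {C C′} → C ⊆ C′ → edgesNotIn C′ ℕ.≤ edgesNotIn C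
  edgesNotIn-mono {C} {C′} C⊆C′ = #subsets-mono (λ S → Edge? S ×-dec ¬? (S ⊆? C′))
    (λ S → Edge? S ×-dec ¬? (S ⊆? C)) (λ S (e , S⊈C′) → e , λ S⊆C → S⊈C′ (C⊆C′ ∘ S⊆C))

  -- An edge without `v` cannot tell `C` from `toggle v C`, so any new edge outside contains `v`.
  edgesNotIn-toggle : ∀ v C → edgesNotIn (toggle v C) ℕ.≤ edgesNotIn C ℕ.+ degree v
  edgesNotIn-toggle v C = begin
    edgesNotIn (toggle v C)
      ≡⟨ #subsets-split (λ S → Edge? S ×-dec ¬? (S ⊆? toggle v C)) (v ∈?_) ⟩
    #subsets (λ S → (Edge? S ×-dec ¬? (S ⊆? toggle v C)) ×-dec v ∈? S) ℕ.+
      #subsets (λ S → (Edge? S ×-dec ¬? (S ⊆? toggle v C)) ×-dec ¬? (v ∈? S))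
      ≤⟨ ℕₚ.+-mono-≤ (#subsets-mono (λ S → (Edge? S ×-dec ¬? (S ⊆? toggle v C)) ×-dec v ∈? S)
        (λ S → Edge? S ×-dec v ∈? S) (λ S ((e , _) , v∈S) → e , v∈S))
                     (#subsets-mono (λ S → (Edge? S ×-dec ¬? (S ⊆? toggle v C)) ×-dec ¬? (v ∈? S))
                       (λ S → Edge? S ×-dec ¬? (S ⊆? C))
                         (λ S ((e , S⊈C′) , v∉S) → e , λ S⊆C → S⊈C′
                         (λ w∈S → ∈-toggle v C (λ { ≡.refl → v∉S w∈S }) (S⊆C w∈S)))) ⟩
    degree v ℕ.+ edgesNotIn C
      ≡⟨ ℕₚ.+-comm (degree v) _ ⟩
    edgesNotIn C ℕ.+ degree v ∎
    where open ℕₚ.≤-Reasoning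

  size≤#ofSize : size ℕ.≤ #ofSize order r
  size≤#ofSize = #subsets-mono Edge? (λ S → ∣ S ∣ ℕₚ.≟ r) (λ S → uniform)

module _ {m} (G : RGraph (suc m)) (v : RGraph.V G) where
  open RGraph G

  -- The vertex set is kept and `v` becomes isolated, so that subsets of the graph and of the link
  -- have the same type.
  link : RGraph m
  link = record
    { order   = order
    ; Edge    = λ S → v ∉ S × Edge (toggle v S)
    ; Edge?   = λ S → ¬? (v ∈? S) ×-dec Edge? (toggle v S)
    ; uniform = λ {S} (v∉S , e) → ℕₚ.suc-injective
      (≡.trans (≡.sym (∣toggle∣-∉ v S v∉S)) (uniform e))
    }

  size-link : RGraph.size link ≡ degree v
  size-link = ≡.trans
    (ℕₚ.≤-antisym (#subsets-mono (RGraph.Edge? link)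
      (λ S → Edge? (toggle v S) ×-dec v ∈? toggle v S) (λ S (v∉S , e) → e , ∉⇒∈-toggle v S v∉S))
                  (#subsets-mono (λ S → Edge? (toggle v S) ×-dec v ∈? toggle v S)
                    (RGraph.Edge? link) (λ S (e , v∈S′) → ∈-toggle⇒∉ v S v∈S′ , e)))
    (#subsets-toggle v (λ S → Edge? S ×-dec v ∈? S))

  -- If `T` together with `v` is a clique, then every `m`-subset of `T` becomes an edge when `v` is
  -- added, so `T` is a clique of the link.
  cliqueDegree≤cliques-link : cliqueDegree G v ℕ.≤ RGraph.cliques link
  cliqueDegree≤cliques-link = ℕₚ.≤-trans
    (ℕₚ.≤-reflexive (≡.sym (#subsets-toggle v (λ T → IsClique? T ×-dec v ∈? T))))
    (#subsets-mono (λ T → IsClique? (toggle v T) ×-dec v ∈? toggle v T)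
      (RGraph.IsClique? link) clique-link)
    where
    clique-link : ∀ T → IsClique (toggle v T) × v ∈ toggle v T → RGraph.IsClique link T
    clique-link T ((∣T′∣≡ , edges) , v∈T′) =
      ℕₚ.suc-injective (≡.trans (≡.sym (∣toggle∣-∉ v T v∉T)) ∣T′∣≡) ,
      λ S S⊆T ∣S∣≡m → (λ v∈S → v∉T (S⊆T v∈S)) ,
        edges (toggle v S) (toggle-mono S S⊆T)
          (≡.trans (∣toggle∣-∉ v S (λ v∈S → v∉T (S⊆T v∈S))) (cong suc ∣S∣≡m))
      where
      v∉T : v ∉ T
      v∉T = ∈-toggle⇒∉ v T v∈T′
      toggle-mono : ∀ S → S ⊆ T → toggle v S ⊆ toggle v T
      toggle-mono S S⊆T {w} w∈S′ with w Finₚ.≟ v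
      ... | yes ≡.refl = v∈T′
      ... | no  w≢v    = ∈-toggle v T w≢v (S⊆T (toggle-∈ v S w≢v w∈S′))

-- Base case of the induction on uniformity. The link is a 0-graph, and any clique in it forces the
-- empty set to be an edge, although the link has `degree v` edges, that is none.
degree≡0⇒cliqueDegree≡0 : (G : RGraph 1)
  (v : RGraph.V G) → RGraph.degree G v ≡ 0 → cliqueDegree G v ≡ 0
degree≡0⇒cliqueDegree≡0 G v d≡0 = ℕₚ.n≤0⇒n≡0 (ℕₚ.≤-trans (cliqueDegree≤cliques-link G v)
  (ℕₚ.≤-reflexive (#subsets-empty (RGraph.IsClique? L) (λ T (_ , edges) →
    ℕₚ.1+n≰n (ℕₚ.≤-trans (#subsets-nonempty (RGraph.Edge? L)
      (edges ⊥ (⊥⊆ {p = T}) (∣⊥∣≡0 (RGraph.order G))))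
      (ℕₚ.≤-reflexive (≡.trans (size-link G v) d≡0)))))))
  where
  L : RGraph 0
  L = link G v

-- The Kruskal-Katona theorem through bounds at each vertex

module KruskalKatona {c ℓ} (F : CompleteOrderedField c ℓ) where
  open OrderedField F
  open Binomial F
  module Sumℝ = Algebra.Properties.CommutativeMonoid.Sum +-commutativeMonoid
  module SumℝS = Algebra.Properties.Semiring.Sum semiring

  ∑ : ∀ {n} → (Fin n → ℝ) → ℝ
  ∑ = Sumℝ.sum

  fromℕ-sum : ∀ {n} (f : Fin n → ℕ) → fromℕ (sum f) ≈ ∑ (fromℕ ∘ f)
  fromℕ-sum {zero}  f = refl
  fromℕ-sum {suc n} f = trans (fromℕ-+ (f zero) _) (+-congˡ (fromℕ-sum (f ∘ suc)))

  ∑-mono : ∀ {n} {f g : Fin n → ℝ} → (∀ i → f i ≤ g i) → ∑ f ≤ ∑ g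
  ∑-mono {zero}  f≤g = ≤-refl
  ∑-mono {suc n} f≤g = +-mono-≤ (f≤g zero) (∑-mono (f≤g ∘ suc))

  ∑-nonNeg : ∀ {n} {f : Fin n → ℝ} → (∀ i → 0# ≤ f i) → 0# ≤ ∑ f
  ∑-nonNeg {zero}  0≤f = ≤-refl
  ∑-nonNeg {suc n} 0≤f = +-nonNeg (0≤f zero) (∑-nonNeg (0≤f ∘ suc))

  ∑-scale : ∀ {n} a (f : Fin n → ℝ) → ∑ (λ i → a * f i) ≈ a * ∑ f
  ∑-scale a f = sym (SumℝS.*-distribˡ-sum a f)

  #ofSize≈binom : ∀ n k → fromℕ (#ofSize n k) ≈ binom (fromℕ n) k
  #ofSize≈binom n zero = trans (reflexive (cong fromℕ (#ofSize-zero n)))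
    (trans (+-identityʳ 1#) (sym (binom-zero (fromℕ n))))
  #ofSize≈binom zero (suc k) = sym (binom-zero-suc k)
  #ofSize≈binom (suc n) (suc k) = trans (reflexive (cong fromℕ (#ofSize-pascal n k)))
    (trans (fromℕ-+ (#ofSize n (suc k)) _)
      (trans (+-cong (#ofSize≈binom n (suc k)) (#ofSize≈binom n k)) (sym (binom-pascal n k))))

  degree-sumℝ : ∀ {r} (G : RGraph r) → let open RGraph G in ∑
    (fromℕ ∘ degree) ≈ fromℕ r * fromℕ size
  degree-sumℝ {r} G = trans (sym (fromℕ-sum (RGraph.degree G)))
    (trans (reflexive (cong fromℕ (degree-sum G))) (fromℕ-* r (RGraph.size G)))

  cliqueDegree-sumℝ : ∀ {r} (G : RGraph r) → let open RGraph G in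
    ∑ (fromℕ ∘ cliqueDegree G) ≈ fromℕ (suc r) * fromℕ cliques
  cliqueDegree-sumℝ {r} G = trans (sym (fromℕ-sum (cliqueDegree G)))
    (trans (reflexive (cong fromℕ (cliqueDegree-sum G))) (fromℕ-* (suc r) (RGraph.cliques G)))

  -- The edges avoiding v are at least as many as the cliques through v.
  cliqueDegree≤avoiding : ∀ {m} (G : RGraph (suc m)) y → let open RGraph G in
    fromℕ size ≤ binom y (suc m) → ∀ v →
    fromℕ (suc m) * fromℕ (cliqueDegree G v) ≤ y * binom (y - 1#) m - fromℕ (suc m) * fromℕ
      (degree v)
  cliqueDegree≤avoiding {m} G y size≤ v = ≤-from-difference
    (difference-nonNeg (*-monoˡ-≤ (fromℕ-nonNeg (suc m))
      (≤-trans (fromℕ-mono-≤ (cliqueDegree+degree≤size G v)) size≤)))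
    (trans (+-congʳ (sym (binom-absorption y m))) (trans
      (solve 4 (λ n b k d → n :* b :- n :* d := n :* k :+ (n :* b :- n :* (k :+ d))) refl
        (fromℕ (suc m)) (binom y (suc m)) (fromℕ (cliqueDegree G v)) (fromℕ (RGraph.degree G v)))
      (+-congˡ (+-congˡ (-‿cong (*-congˡ (sym (fromℕ-+ (cliqueDegree G v) _))))))))

  mutual
    -- Lovász's form of the Kruskal–Katona theorem, with the real y only
    -- bounding the size, so that binom y need not be inverted.
    kruskal-katona : ∀ m (G : RGraph (suc m)) y → let open RGraph G in
      fromℕ m ≤ y → fromℕ size ≤ binom y (suc m) →
      fromℕ (suc (suc m)) * fromℕ cliques ≤ (y - fromℕ (suc m)) * fromℕ size
    kruskal-katona m G y m≤y size≤ = *-cancelˡ-≤ (fromℕ-pos m) (begin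
      N * (fromℕ (suc (suc m)) * fromℕ cliques)        ≈⟨ *-congˡ (sym (cliqueDegree-sumℝ G)) ⟩
      N * ∑ (fromℕ ∘ cliqueDegree G)
        ≈⟨ sym (∑-scale {order} N (fromℕ ∘ cliqueDegree G)) ⟩
      ∑ (λ v → N * fromℕ (cliqueDegree G v))           ≤⟨ ∑-mono (vertex-bound m G y m≤y size≤) ⟩
      ∑ (λ v → (y - N) * fromℕ (degree v))             ≈⟨ ∑-scale {order} (y - N) (fromℕ ∘ degree) ⟩
      (y - N) * ∑ (fromℕ ∘ degree)                     ≈⟨ *-congˡ (degree-sumℝ G) ⟩
      (y - N) * (N * fromℕ size)
        ≈⟨ solve 3 (λ z n s → z :* (n :* s) := n :* (z :* s)) refl (y - N) N (fromℕ size) ⟩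
      N * ((y - N) * fromℕ size)                       ∎)
      where
      open RGraph G
      N : ℝ
      N = fromℕ (suc m)
      open import Relation.Binary.Reasoning.PartialOrder poset

    vertex-bound : ∀ m (G : RGraph (suc m)) y → let open RGraph G in
      fromℕ m ≤ y → fromℕ size ≤ binom y (suc m) → ∀ v →
      fromℕ (suc m) * fromℕ (cliqueDegree G v) ≤ (y - fromℕ (suc m)) * fromℕ (degree v)
    vertex-bound m G y m≤y size≤ v with binom (y - 1#) m ≤? fromℕ (RGraph.degree G v)
    -- With `b ≤ d`, the bound `y b - (m + 1) d` from the avoiding edges is at most
    -- `(y - (m + 1)) d`.
    vertex-bound m G y m≤y size≤ v | yes b≤d = ≤-trans (cliqueDegree≤avoiding G y size≤ v)
      (≤-from-difference (*-nonNeg (≤-trans (fromℕ-nonNeg m) m≤y) (difference-nonNeg b≤d))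
        (solve 4 (λ y n d b → (y :- n) :* d := (y :* b :- n :* d) :+ y :* (d :- b)) refl y
          (fromℕ (suc m)) (fromℕ (RGraph.degree G v)) (binom (y - 1#) m)))
    -- The threshold `binom (y - 1#) 0` is 1, so the degree is zero and both sides vanish.
    vertex-bound zero G y m≤y size≤ v | no b≰d = ≤-reflexive
      (trans (zeroed (degree≡0⇒cliqueDegree≡0 G v d≡0)) (sym (zeroed d≡0)))
      where
      d≡0 : RGraph.degree G v ≡ 0
      d≡0 = ℕₚ.n<1⇒n≡0 (fromℕ-cancel-<
        (<-≤-trans (≰⇒> b≰d) (≤-reflexive (trans (binom-zero (y - 1#)) (sym (+-identityʳ 1#))))))
      zeroed : ∀ {a k} → k ≡ 0 → a * fromℕ k ≈ 0#
      zeroed {a} k≡0 = trans (*-congˡ (reflexive (cong fromℕ k≡0))) (zeroʳ a)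
    -- The degree is below `binom (y - 1#) (suc m)`, so the link obeys the theorem with `y - 1#`;
    -- lowering `y` and the uniformity together leaves their difference unchanged.
    vertex-bound (suc m) G y m≤y size≤ v | no b≰d = ≤-trans
      (link-bound m G (y - 1#) (≤-from-difference (difference-nonNeg m≤y)
        (solve 2 (λ y m → y :- con (+ 1) := m :+ (y :- (con (+ 1) :+ m))) refl y (fromℕ m))) v
          (proj₁ (≰⇒> b≰d)))
      (≤-reflexive (*-congʳ (solve 2 (λ y m → (y :- con (+ 1)) :- m := y :- (con (+ 1) :+ m)) refl y
        (fromℕ (suc m)))))

    -- The theorem for the link, whose uniformity is one less, which closes the recursion. The bound
    -- `z` is left free because smaller values than `y - 1#` are what later produce a positive
    -- defect.
    link-bound : ∀ m (G : RGraph (suc (suc m))) z → let open RGraph G in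
      fromℕ m ≤ z → ∀ v → fromℕ (degree v) ≤ binom z (suc m) →
      fromℕ (suc (suc m)) * fromℕ (cliqueDegree G v) ≤ (z - fromℕ (suc m)) * fromℕ (degree v)
    link-bound m G z m≤z v d≤ = ≤-trans
      (*-monoˡ-≤ (fromℕ-nonNeg (suc (suc m))) (fromℕ-mono-≤ (cliqueDegree≤cliques-link G v)))
      (≤-trans (kruskal-katona m (link G v) z m≤z (≤-trans (≤-reflexive size≈d) d≤))
        (≤-reflexive (*-congˡ size≈d)))
      where
      size≈d : fromℕ (RGraph.size (link G v)) ≈ fromℕ (RGraph.degree G v)
      size≈d = reflexive (cong fromℕ (size-link G v))

-- Sets cut out by a predicate, sums over them, and ceilings

subsetOf : ∀ {n p} {P : Pred (Fin n) p} → Decidable P → Subset n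
subsetOf P? = Vec.tabulate (does ∘ P?)

∈-subsetOf⁺ : ∀ {n p} {P : Pred (Fin n) p} (P? : Decidable P) {v} → P v → v ∈ subsetOf P?
∈-subsetOf⁺ P? {v} Pv = Vecₚ.lookup⇒[]= v _
  (≡.trans (Vecₚ.lookup∘tabulate (does ∘ P?) v) (dec-true (P? v) Pv))

∈-subsetOf⁻ : ∀ {n p} {P : Pred (Fin n) p} (P? : Decidable P) {v} → v ∈ subsetOf P? → P v
∈-subsetOf⁻ P? {v} v∈ with P? v | ≡.trans (≡.sym (Vecₚ.lookup∘tabulate (does ∘ P?) v))
  (Vecₚ.[]=⇒lookup v∈)
... | yes Pv | _  = Pv
... | no _   | ()

module IndicatorSums {c ℓ} (F : CompleteOrderedField c ℓ) where
  open OrderedField F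
  open KruskalKatona F

  χ : ∀ {a} {A : Set a} → Dec A → ℝ
  χ a? = fromℕ (indicator a?)

  restricted-sum : ∀ {n p} {P : Pred (Fin n) p} (P? : Decidable P) (f : Fin n → ℕ) →
    fromℕ (sum (λ v → indicator (P? v) ℕ.* f v)) ≈ ∑ (λ v → χ (P? v) * fromℕ (f v))
  restricted-sum P? f = trans (fromℕ-sum (λ v → indicator (P? v) ℕ.* f v))
    (Sumℝ.sum-cong-≋ (λ v → fromℕ-* (indicator (P? v)) (f v)))

  ∣S∣-sumℝ : ∀ {n} (S : Subset n) → fromℕ ∣ S ∣ ≈ ∑ (λ v → χ (v ∈? S))
  ∣S∣-sumℝ S = trans (reflexive (cong fromℕ (∣S∣≡sum S))) (fromℕ-sum (λ v → indicator (v ∈? S)))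

  χ-bound : ∀ {a} {A : Set a} (a? : Dec A) {b f g} → 0# ≤ g → (A → b * f ≤ g) → b * (χ a? * f) ≤ g
  χ-bound (yes x) {b} {f} 0≤g bf≤g = ≤-trans
    (≤-reflexive (solve 2 (λ b f → b :* ((con (+ 1) :+ con (+ 0)) :* f) := b :* f) refl b f))
      (bf≤g x)
  χ-bound (no _)  {b} {f} 0≤g bf≤g = ≤-trans
    (≤-reflexive (solve 2 (λ b f → b :* (con (+ 0) :* f) := con (+ 0)) refl b f)) 0≤g

  -- Markov's inequality: the vertices outside `P` contribute only nonnegative terms to `∑ g`.
  restricted-bound : ∀ {n p} {P : Pred (Fin n) p} (P? : Decidable P) a (f g : Fin n → ℝ) →
    (∀ v → 0# ≤ g v) → (∀ v → P v → a * f v ≤ g v) → a * ∑ (λ v → χ (P? v) * f v) ≤ ∑ g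
  restricted-bound P? a f g 0≤g af≤g = ≤-trans
    (≤-reflexive (sym (∑-scale a (λ v → χ (P? v) * f v))))
    (∑-mono (λ v → χ-bound (P? v) (0≤g v) (af≤g v)))

  -- Found by descending from a natural upper bound. That bound is kept in the result so that a set
  -- of `k` vertices exists when `n` is the order.
  ceiling : ∀ {x} → 0# ≤ x → ∀ n → x ≤ fromℕ n → ∃[ k ] k ℕ.≤ n × IsCeiling k x
  ceiling {x} 0≤x zero x≤0 = 0 , z≤n , x≤0 , <-from-difference
    (<-≤-trans 0<1 (≤-from-difference 0≤x (+-comm x 1#))) (sym (+-identityˡ _))
  ceiling {x} 0≤x (suc n) x≤n+1 with x ≤? fromℕ n
  ... | no x≰n = suc n , ℕₚ.≤-refl , x≤n+1 , <-from-difference (difference-pos (≰⇒> x≰n))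
    (solve 2 (λ x n → x :+ con (+ 1) := (con (+ 1) :+ n) :+ (x :- n)) refl x (fromℕ n))
  ... | yes x≤n with ceiling 0≤x n x≤n
  ... | k , k≤n , isCeil = k , ℕₚ.m≤n⇒m≤1+n k≤n , isCeil

-- Graphs with nearly the maximal number of cliques

module Stability {c ℓ} (F : CompleteOrderedField c ℓ) where
  open OrderedField F
  open Binomial F
  open KruskalKatona F
  open IndicatorSums F
  open import Relation.Binary.Reasoning.PartialOrder poset

  -- Here `s` is `√δ`, and `ε` has been absorbed into `12 r s ≤ 1` and `r + 1 ≤ x`. Writing `r` as
  -- `k + 2` makes the link a `suc k`-graph, as `link-bound` requires.
  module NearExtremal (k : ℕ) (x s : ℝ) (0≤s : 0# ≤ s)
    (12rs≤1 : fromℕ 12 * fromℕ (suc (suc k)) * s ≤ 1#) (r+1≤x : fromℕ (suc (suc (suc k))) ≤ x)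
    (G : RGraph (suc (suc k))) (size≈ : fromℕ (RGraph.size G) ≈ binom x (suc (suc k)))
    (cliques> : (1# - s * s) * binom x (suc (suc (suc k))) < fromℕ (RGraph.cliques G)) where

    open RGraph G

    r : ℕ
    r = suc (suc k)

    m : ℕ
    m = suc k

    -- `D` is the degree in a complete `r`-graph on `x` vertices, and `T` is `s²` times
    -- `r (r + 1) binom x (r + 1)`: the total defect that the clique hypothesis allows.
    M R D T : ℝ
    M = fromℕ m
    R = fromℕ r
    D = binom (x - 1#) m
    T = s * (s * ((x - R) * (x * D)))

    -- The defect is the slack in `vertex-bound`; it vanishes throughout a complete `r`-graph on `x`
    -- vertices. The form `(- R) * κ v` lets sums distribute by `∑-distrib-+` and `∑-scale`.
    d κ defect : V → ℝ
    d v = fromℕ (degree v)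
    κ v = fromℕ (cliqueDegree G v)
    defect v = (x - R) * d v + (- R) * κ v

    0≤M : 0# ≤ M
    0≤M = fromℕ-nonNeg m

    0≤R : 0# ≤ R
    0≤R = fromℕ-nonNeg r

    0<R : 0# < R
    0<R = fromℕ-pos m

    0≤Ms : 0# ≤ M * s
    0≤Ms = *-nonNeg 0≤M 0≤s

    1≤M : 1# ≤ M
    1≤M = ≤-from-difference (fromℕ-nonNeg k) refl

    0≤x-R-1 : 0# ≤ x - (1# + R)
    0≤x-R-1 = difference-nonNeg r+1≤x

    0<x-R : 0# < x - R
    0<x-R = <-≤-trans 0<1 (≤-from-difference 0≤x-R-1
      (solve 2 (λ x r → x :- r := con (+ 1) :+ (x :- (con (+ 1) :+ r))) refl x R))

    0<w : 0# < x - M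
    0<w = <-≤-trans 0<x-R (≤-from-difference (proj₁ 0<1)
      (solve 2 (λ x m → x :- m := x :- (con (+ 1) :+ m) :+ con (+ 1)) refl x M))

    0<x-1 : 0# < x - 1#
    0<x-1 = <-≤-trans 0<w (≤-from-difference (difference-nonNeg 1≤M)
      (solve 2 (λ x m → x :- con (+ 1) := x :- m :+ (m :- con (+ 1))) refl x M))

    0<x : 0# < x
    0<x = <-≤-trans 0<w (≤-from-difference 0≤M (solve 2 (λ x m → x := x :- m :+ m) refl x M))

    0<D : 0# < D
    0<D = binom-pos m (<-from-difference 0<w
      (solve 2 (λ x m → (x :- con (+ 1)) :+ con (+ 1) := m :+ (x :- m)) refl x M))

    0≤D : 0# ≤ D
    0≤D = proj₁ 0<D

    0<xD : 0# < x * D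
    0<xD = *-pos 0<x 0<D

    R*size≈xD : R * fromℕ size ≈ x * D
    R*size≈xD = trans (*-congˡ size≈) (binom-absorption x m)

    12Ms+12s≤1 : fromℕ 12 * (M * s) + fromℕ 12 * s ≤ 1#
    12Ms+12s≤1 = ≤-trans (≤-reflexive
      (solve 2 (λ m s → con (+ 12) :* (m :* s) :+ con (+ 12) :* s :=
        con (+ 12) :* (con (+ 1) :+ m) :* s) refl M s)) 12rs≤1

    s≤1 : s ≤ 1#
    s≤1 = ≤-trans (≤-from-difference
      (+-nonNeg (*-nonNeg (fromℕ-nonNeg 12) 0≤Ms) (*-nonNeg (fromℕ-nonNeg 11) 0≤s))
      (solve 2 (λ m s → con (+ 12) :* (m :* s) :+ con (+ 12) :* s := s
        :+ (con (+ 12) :* (m :* s) :+ con (+ 11) :* s)) refl M s)) 12Ms+12s≤1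

    defect-nonNeg : ∀ v → 0# ≤ defect v
    defect-nonNeg v = ≤-trans (difference-nonNeg (vertex-bound m G x (≤-from-difference (proj₁ 0<w)
        (solve 2 (λ x m → x := m :+ (x :- m)) refl x M)) (≤-reflexive size≈) v))
      (≤-reflexive (solve 4 (λ x r d k → (x :- r) :* d :- r :* k := (x :- r) :* d :+ (:- r) :* k)
        refl x R (d v) (κ v)))

    ∑d≈xD : ∑ d ≈ x * D
    ∑d≈xD = trans (degree-sumℝ G) R*size≈xD

    ∑defect≈ : ∑ defect ≈ (x - R) * (x * D) - R * ((1# + R) * fromℕ cliques)
    ∑defect≈ = begin-equality
      ∑ defect
        ≈⟨ Sumℝ.∑-distrib-+ (λ v → (x - R) * d v) (λ v → (- R) * κ v) ⟩
      ∑ (λ v → (x - R) * d v) + ∑ (λ v → (- R) * κ v)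
        ≈⟨ +-cong (∑-scale (x - R) d) (∑-scale (- R) κ) ⟩
      (x - R) * ∑ d + (- R) * ∑ κ
        ≈⟨ +-cong (*-congˡ ∑d≈xD) (*-congˡ (cliqueDegree-sumℝ G)) ⟩
      (x - R) * (x * D) + (- R) * ((1# + R) * fromℕ cliques)
        ≈⟨ solve 3 (λ a r k → a :+ (:- r) :* ((con (+ 1) :+ r) :* k) :=
          a :- r :* ((con (+ 1) :+ r) :* k)) refl ((x - R) * (x * D)) R (fromℕ cliques) ⟩
      (x - R) * (x * D) - R * ((1# + R) * fromℕ cliques)  ∎

    R*binom≈ : R * ((1# + R) * binom x (suc r)) ≈ (x - R) * (x * D)
    R*binom≈ = begin-equality
      R * ((1# + R) * binom x (suc r))   ≈⟨ *-congˡ (binom-suc x r) ⟩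
      R * (binom x r * (x - R))
        ≈⟨ solve 3 (λ r b z → r :* (b :* z) := z :* (r :* b)) refl R (binom x r) (x - R) ⟩
      (x - R) * (R * binom x r)          ≈⟨ *-congˡ (binom-absorption x m) ⟩
      (x - R) * (x * D)                  ∎

    -- By double counting, the defects sum to `r (r + 1)` times the difference of `binom x (r + 1)`
    -- and the number of cliques, a difference below `s² binom x (r + 1)`.
    ∑defect<T : ∑ defect < T
    ∑defect<T = <-from-difference (*-pos (*-pos 0<R (fromℕ-pos r)) (difference-pos cliques>))
      (begin-equality
      s * (s * ((x - R) * (x * D)))
        ≈⟨ *-congˡ (*-congˡ (sym R*binom≈)) ⟩
      s * (s * (R * ((1# + R) * B)))
        ≈⟨ solve 4 (λ s r b k → s :* (s :* (r :* ((con (+ 1) :+ r) :* b))) :=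
             r :* ((con (+ 1) :+ r) :* b) :- r :* ((con (+ 1) :+ r) :* k)
               :+ r :* (con (+ 1) :+ r) :* (k :- (con (+ 1) :- s :* s) :* b))
             refl s R B (fromℕ cliques) ⟩
      R * ((1# + R) * B) - R * ((1# + R) * fromℕ cliques) + R * (1# + R) *
        (fromℕ cliques - (1# - s * s) * B)
        ≈⟨ +-congʳ (+-congʳ R*binom≈) ⟩
      (x - R) * (x * D) - R * ((1# + R) * fromℕ cliques) + R * (1# + R) *
        (fromℕ cliques - (1# - s * s) * B)
        ≈⟨ +-congʳ (sym ∑defect≈) ⟩
      ∑ defect + R * (1# + R) * (fromℕ cliques - (1# - s * s) * B) ∎)
      where
      B : ℝ
      B = binom x (suc r)

    -- Were `s` zero, `T` would be zero, yet a sum of nonnegative defects lies strictly below it.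
    -- Positivity permits cancelling `s` below.
    0<s : 0# < s
    0<s = 0≤s , λ 0≈s → <⇒≱ (≤-<-trans (∑-nonNeg defect-nonNeg) ∑defect<T)
      (≤-reflexive (trans (*-congʳ (sym 0≈s)) (zeroˡ _)))

    ∑defect≤T : ∑ defect ≤ T
    ∑defect≤T = proj₁ ∑defect<T

    -- Vertices of high and of low degree

    high? : Decidable (λ v → (1# + s) * D < d v)
    high? v = (1# + s) * D <? d v

    -- Bounding the cliques by the edges avoiding `v` gives a defect of at least `x (d - D)`. The
    -- trailing `* 1#` matches the constant function in `restricted-bound`.
    high-defect : ∀ v → (1# + s) * D < d v → (x * (s * D)) * 1# ≤ defect v
    high-defect v (sD≤ , _) = ≤-from-difference
      (+-nonNeg (difference-nonNeg (cliqueDegree≤avoiding G x (≤-reflexive size≈) v))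
        (*-nonNeg (proj₁ 0<x) (difference-nonNeg sD≤)))
      (solve 6 (λ x r d k s b → (x :- r) :* d :+ (:- r) :* k :=
        (x :* (s :* b)) :* con (+ 1)
          :+ (((x :* b :- r :* d) :- r :* k) :+ x :* (d :- (con (+ 1) :+ s) :* b)))
        refl x R (d v) (κ v) s D)

    few-high : fromℕ (#vertices high?) ≤ s * x
    few-high = *-cancelˡ-≤ (*-pos 0<x (*-pos 0<s 0<D)) (begin
      (x * (s * D)) * fromℕ (#vertices high?)
        ≈⟨ *-congˡ (trans (reflexive (cong fromℕ (#vertices≡sum high?)))
          (trans (fromℕ-sum (indicator ∘ high?))
          (Sumℝ.sum-cong-≋ (λ v → sym (*-identityʳ (χ (high? v))))))) ⟩
      (x * (s * D)) * ∑ (λ v → χ (high? v) * 1#)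
        ≤⟨ restricted-bound high? (x * (s * D)) (λ _ → 1#) defect defect-nonNeg high-defect ⟩
      ∑ defect                                       ≤⟨ ∑defect≤T ⟩
      T
        -- This replaces `x - r` by `x`.
        ≤⟨ ≤-from-difference (*-nonNeg (*-nonNeg 0≤s 0≤s) (*-nonNeg 0≤R (proj₁ 0<xD)))
        (solve 4 (λ x s r b → (x :* (s :* b)) :* (s :* x) := s :* (s :* ((x :- r) :* (x :* b)))
          :+ (s :* s) :* (r :* (x :* b))) refl x s R D) ⟩
      (x * (s * D)) * (s * x)                        ∎)

    z : ℝ
    z = (1# - s) * (x - 1#)

    low? : Decidable (λ v → d v < binom z m)
    low? v = d v <? binom z m

    -- `z ≥ (1 - s) r = r - r s`, and `r s ≤ 1/12`, so `z` is above `r - 2`.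
    k≤z : fromℕ k ≤ z
    k≤z = ≤-from-difference
      (+-nonNeg (+-nonNeg (*-nonNeg (difference-nonNeg s≤1) 0≤x-R-1) (difference-nonNeg 12Ms+12s≤1))
        (+-nonNeg (proj₁ 0<1) (+-nonNeg (*-nonNeg (fromℕ-nonNeg 11) 0≤Ms)
          (*-nonNeg (fromℕ-nonNeg 11) 0≤s))))
      (solve 3 (λ x s k → (con (+ 1) :- s) :* (x :- con (+ 1)) := k :+
        ((con (+ 1) :- s) :* (x :- (con (+ 1) :+ (con (+ 1) :+ (con (+ 1) :+ k))))
          :+ (con (+ 1) :- (con (+ 12) :* ((con (+ 1) :+ k) :* s) :+ con (+ 12) :* s))
        :+ (con (+ 1) :+ (con (+ 11) :* ((con (+ 1) :+ k) :* s) :+ con (+ 11) :* s))))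
        refl x s (fromℕ k))

    -- `link-bound` at `z` gives `r κ ≤ (z - m) d`, and `(x - r) - (z - m) = (x - 1) - z = s (x -
    -- 1)`.
    low-defect : ∀ v → d v < binom z m → (s * (x - 1#)) * d v ≤ defect v
    low-defect v (d≤ , _) = ≤-from-difference (difference-nonNeg (link-bound k G z k≤z v d≤))
      (solve 5 (λ x m s d k → (x :- (con (+ 1) :+ m)) :* d :+ (:- (con (+ 1) :+ m)) :* k :=
        (s :* (x :- con (+ 1))) :* d
          :+ (((con (+ 1) :- s) :* (x :- con (+ 1)) :- m) :* d :- (con (+ 1) :+ m) :* k))
        refl x M s (d v) (κ v))

    low-edges : fromℕ (edgesIncidentTo low?) ≤ s * x * D
    low-edges = *-cancelˡ-≤ (*-pos 0<s 0<x-1) (begin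
      (s * (x - 1#)) * fromℕ (edgesIncidentTo low?)
        ≤⟨ *-monoˡ-≤ (proj₁ (*-pos 0<s 0<x-1))
          (≤-trans (fromℕ-mono-≤ (edgesIncidentTo≤ G low?))
          (≤-reflexive (restricted-sum low? degree))) ⟩
      (s * (x - 1#)) * ∑ (λ v → χ (low? v) * d v)
        ≤⟨ restricted-bound low? (s * (x - 1#)) d defect defect-nonNeg low-defect ⟩
      ∑ defect                                       ≤⟨ ∑defect≤T ⟩
      T
        -- This replaces `x - r` by `x - 1`.
        ≤⟨ ≤-from-difference (*-nonNeg (*-nonNeg 0≤s 0≤s) (*-nonNeg 0≤M (proj₁ 0<xD)))
        (solve 4 (λ x s m b → (s :* (x :- con (+ 1))) :* (s :* x :* b) :=
          s :* (s :* ((x :- (con (+ 1) :+ m)) :* (x :* b))) :+ (s :* s) :* (m :* (x :* b)))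
            refl x s M D) ⟩
      (s * (x - 1#)) * (s * x * D)                   ∎)

    -- Kruskal–Katona in the link, at the y with d v ≤ binom y m given by binom-shrink.
    defect-lower-bound : ∀ v → d v ≤ D → (x - M) * ((D - d v) * d v) ≤ (M * D) * defect v
    defect-lower-bound v d≤D = begin
      (x - M) * ((D - d v) * d v)
        ≈⟨ solve 3 (λ w e d → w :* (e :* d) := (e :* con (+ 1)) :* (w :* d)) refl (x - M) (D - d v)
          (d v) ⟩
      ((D - d v) * 1#) * ((x - M) * d v)
        ≈⟨ *-congʳ (*-congˡ (sym (*-inverseʳ (M * D) (pos⇒≉0 0<MD)))) ⟩
      ((D - d v) * (M * D * I)) * ((x - M) * d v)
        ≈⟨ solve 5 (λ e a i w d → (e :* (a :* i)) :* (w :* d) := a :* ((e :* i) :* w :* d)) refl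
          (D - d v) (M * D) I (x - M) (d v) ⟩
      (M * D) * (t * (x - M) * d v)      ≤⟨ *-monoˡ-≤ (proj₁ 0<MD) tw≤ ⟩
      (M * D) * defect v                 ∎
      where
      0<MD : 0# < M * D
      0<MD = *-pos (fromℕ-pos k) 0<D
      I t y : ℝ
      I = (M * D) ⁻¹
      -- Chosen so that `(1 - M t) D = d v`. The `w` of `binom-shrink` is `x - M`, the smallest
      -- factor of `D`, so that `y` lies `t (x - M)` below `x - 1`; this gap becomes the defect per
      -- unit of degree.
      t = (D - d v) * I
      y = (x - 1#) - t * (x - M)
      0≤I : 0# ≤ I
      0≤I = proj₁ (⁻¹-pos 0<MD)
      0≤t : 0# ≤ t
      0≤t = *-nonNeg (difference-nonNeg d≤D) 0≤I
      t≤1 : t ≤ 1#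
      t≤1 = ≤-trans (*-monoʳ-≤ 0≤I
        (≤-from-difference (+-nonNeg (fromℕ-nonNeg (degree v))
          (*-nonNeg (difference-nonNeg 1≤M) 0≤D))
          (solve 3 (λ m b d → m :* b := (b :- d) :+ (d :+ (m :- con (+ 1)) :* b)) refl M D (d v))))
        (≤-reflexive (*-inverseʳ (M * D) (pos⇒≉0 0<MD)))
      d≤binom : d v ≤ binom y m
      d≤binom = begin
        d v                     ≈⟨ solve 2 (λ d b → d := b :- (b :- d) :* con (+ 1)) refl (d v) D ⟩
        D - (D - d v) * 1#
          ≈⟨ +-congˡ (-‿cong (*-congˡ (sym (*-inverseʳ (M * D) (pos⇒≉0 0<MD))))) ⟩
        D - (D - d v) * (M * D * I)
          ≈⟨ solve 4 (λ b e m i → b :- e :* (m :* b :* i) := (con (+ 1) :- m :* (e :* i)) :* b)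
            refl D (D - d v) M I ⟩
        (1# - M * t) * D
          ≤⟨ binom-shrink 0≤t t≤1 (proj₁ 0<w) m
            (≤-reflexive (solve 2 (λ x m → m :+ (x :- m) := (x :- con (+ 1)) :+ con (+ 1))
            refl x M)) ⟩
        binom y m               ∎
      k≤y : fromℕ k ≤ y
      k≤y = ≤-from-difference (*-nonNeg (difference-nonNeg t≤1) (proj₁ 0<w))
        (solve 3 (λ x k t → (x :- con (+ 1)) :- t :* (x :- (con (+ 1) :+ k)) := k
          :+ (con (+ 1) :- t) :* (x :- (con (+ 1) :+ k))) refl x (fromℕ k) t)
      tw≤ : t * (x - M) * d v ≤ defect v
      tw≤ = ≤-from-difference (difference-nonNeg (link-bound k G y k≤y v d≤binom))
        (solve 5 (λ x m t d k → (x :- (con (+ 1) :+ m)) :* d :+ (:- (con (+ 1) :+ m)) :* k :=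
          t :* (x :- m) :* d :+ ((((x :- con (+ 1)) :- t :* (x :- m)) :- m) :* d :- (con (+ 1) :+ m)
            :* k))
          refl x M t (d v) (κ v))

    -- The set of vertices of degree at least half of `D`

    large? : Decidable (λ v → D ≤ d v + d v)
    large? v = D ≤? (d v + d v)

    C : Subset order
    C = subsetOf large?

    -- In the lower bound by `(D - d) d`, one factor is at least `D / 2` on each side of the
    -- threshold when `d ≤ D`. The scaling by `2 M` absorbs that half and the `M` of
    -- `defect-lower-bound`.
    cost : V → ℝ
    cost v = fromℕ 2 * M * defect v

    cost-nonNeg : ∀ v → 0# ≤ cost v
    cost-nonNeg v = *-nonNeg (*-nonNeg (fromℕ-nonNeg 2) 0≤M) (defect-nonNeg v)

    inside-cost : ∀ v → v ∈ C → (x - M) * (D - d v) ≤ cost v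
    inside-cost v v∈C with d v ≤? D
    -- Beyond `D` the left side is nonpositive.
    ... | no d≰D = ≤-trans (≤-from-difference
      (*-nonNeg (proj₁ 0<w) (difference-nonNeg (proj₁ (≰⇒> d≰D))))
            (solve 3 (λ w b d → con (+ 0) := w :* (b :- d) :+ w :* (d :- b)) refl (x - M) D (d v)))
              (cost-nonNeg v)
    ... | yes d≤D = *-cancelˡ-≤ 0<D (≤-from-difference
            (+-nonNeg (*-nonNeg (fromℕ-nonNeg 2) (difference-nonNeg (defect-lower-bound v d≤D)))
                      (*-nonNeg (*-nonNeg (proj₁ 0<w) (difference-nonNeg d≤D))
                        (difference-nonNeg (∈-subsetOf⁻ large? v∈C))))
            (solve 5 (λ w b d m f → b :* (con (+ 2) :* m :* f) := b :* (w :* (b :- d)) :+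
              (con (+ 2) :* ((m :* b) :* f :- w :* ((b :- d) :* d))
                :+ w :* (b :- d) :* (d :+ d :- b)))
              refl (x - M) D (d v) M (defect v)))

    outside-cost : ∀ v → v ∉ C → (x - M) * d v ≤ cost v
    outside-cost v v∉C = *-cancelˡ-≤ 0<D (≤-from-difference
      (+-nonNeg (*-nonNeg (fromℕ-nonNeg 2) (difference-nonNeg (defect-lower-bound v d≤D)))
                (*-nonNeg (*-nonNeg (proj₁ 0<w) (fromℕ-nonNeg (degree v)))
                  (difference-nonNeg 2d≤D)))
      (solve 5 (λ w b d m f → b :* (con (+ 2) :* m :* f) := b :* (w :* d) :+
        (con (+ 2) :* ((m :* b) :* f :- w :* ((b :- d) :* d)) :+ w :* d :* (b :- (d :+ d))))
        refl (x - M) D (d v) M (defect v)))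
      where
      2d≤D : d v + d v ≤ D
      2d≤D = proj₁ (≰⇒> (v∉C ∘ ∈-subsetOf⁺ large?))
      d≤D : d v ≤ D
      d≤D = ≤-trans (≤-from-difference (fromℕ-nonNeg (degree v)) refl) 2d≤D

    -- The total cost is at most `2 M T`; dividing by `x - M`, which is at least `x - r`, leaves
    -- this.
    L : ℝ
    L = fromℕ 2 * M * (s * s) * (x * D)

    ∑cost≤wL : ∑ cost ≤ (x - M) * L
    ∑cost≤wL = begin
      ∑ cost                   ≈⟨ ∑-scale (fromℕ 2 * M) defect ⟩
      fromℕ 2 * M * ∑ defect   ≤⟨ *-monoˡ-≤ (*-nonNeg (fromℕ-nonNeg 2) 0≤M) ∑defect≤T ⟩
      fromℕ 2 * M * T
        ≤⟨ ≤-from-difference (*-nonNeg (*-nonNeg (*-nonNeg (fromℕ-nonNeg 2) 0≤M) (*-nonNeg 0≤s 0≤s))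
          (proj₁ 0<xD))
        (solve 4 (λ x m s b → (x :- m) :* (con (+ 2) :* m :* (s :* s) :* (x :* b)) :=
          con (+ 2) :* m :* (s :* (s :* ((x :- (con (+ 1) :+ m)) :* (x :* b))))
            :+ con (+ 2) :* m :* (s :* s) :* (x :* b)) refl x M s D) ⟩
      (x - M) * L              ∎

    outside-degrees : ∑ (λ v → χ (¬? (v ∈? C)) * d v) ≤ L
    outside-degrees = *-cancelˡ-≤ 0<w (≤-trans
      (restricted-bound (λ v → ¬? (v ∈? C)) (x - M) d cost cost-nonNeg outside-cost) ∑cost≤wL)

    inside-shortfall : ∑ (λ v → χ (v ∈? C) * (D - d v)) ≤ L
    inside-shortfall = *-cancelˡ-≤ 0<w (≤-trans
      (restricted-bound (_∈? C) (x - M) (λ v → D - d v) cost cost-nonNeg inside-cost) ∑cost≤wL)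

    -- Summed over all vertices, this bounds `D |C|` by the shortfall inside `C` plus the degree sum
    -- `x D`.
    χD≤ : ∀ {a} {A : Set a} (a? : Dec A) v → D * χ a? ≤ χ a? * (D - d v) + d v
    χD≤ (yes _) v = ≤-reflexive
      (solve 2 (λ b d → b :* (con (+ 1) :+ con (+ 0)) := (con (+ 1) :+ con (+ 0)) :* (b :- d) :+ d)
        refl D (d v))
    χD≤ (no _)  v = ≤-from-difference (fromℕ-nonNeg (degree v))
      (solve 2 (λ b d → con (+ 0) :* (b :- d) :+ d := b :* con (+ 0) :+ d) refl D (d v))

    ∣C∣≤ : fromℕ ∣ C ∣ ≤ x + fromℕ 2 * M * (s * s) * x
    ∣C∣≤ = *-cancelˡ-≤ 0<D (begin
      D * fromℕ ∣ C ∣                                        ≈⟨ *-congˡ (∣S∣-sumℝ C) ⟩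
      D * ∑ (λ v → χ (v ∈? C))                               ≈⟨ sym (∑-scale D (λ v → χ (v ∈? C))) ⟩
      ∑ (λ v → D * χ (v ∈? C))                               ≤⟨ ∑-mono (λ v → χD≤ (v ∈? C) v) ⟩
      ∑ (λ v → χ (v ∈? C) * (D - d v) + d v)
        ≈⟨ Sumℝ.∑-distrib-+ (λ v → χ (v ∈? C) * (D - d v)) d ⟩
      ∑ (λ v → χ (v ∈? C) * (D - d v)) + ∑ d
        ≤⟨ +-mono-≤ inside-shortfall (≤-reflexive ∑d≈xD) ⟩
      L + x * D
        ≈⟨ solve 4 (λ m s x b → con (+ 2) :* m :* (s :* s) :* (x :* b) :+ x :* b :=
          b :* (x :+ con (+ 2) :* m :* (s :* s) :* x)) refl M s x D ⟩
      D * (x + fromℕ 2 * M * (s * s) * x)                    ∎)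

    -- `2 M s² < 3 R s`, because `0 < s ≤ 1` and `M < R`.
    ∣C∣< : fromℕ ∣ C ∣ < (1# + fromℕ 3 * R * s) * x
    ∣C∣< = ≤-<-trans ∣C∣≤ (<-from-difference
      (*-pos (*-pos 0<s 0<x) (<-≤-trans 0<1 (≤-from-difference
        (+-nonNeg (+-nonNeg (fromℕ-nonNeg 2) 0≤M)
          (*-nonNeg (*-nonNeg (fromℕ-nonNeg 2) 0≤M) (difference-nonNeg s≤1))) refl)))
      (solve 3 (λ m s x → (con (+ 1) :+ con (+ 3) :* (con (+ 1) :+ m) :* s) :* x :=
        x :+ con (+ 2) :* m :* (s :* s) :* x
          :+ s :* x :* (con (+ 1) :+ (con (+ 2) :+ m :+ con (+ 2) :* m :* (con (+ 1) :- s))))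
        refl M s x))

    -- Nonnegative defect gives `R κ ≤ (x - R) d` at each vertex, and the degrees outside `C` total
    -- at most `L`.
    outside-cliques : R * ∑ (λ v → χ (¬? (v ∈? C)) * κ v) ≤ (x - R) * L
    outside-cliques = begin
      R * ∑ (λ v → χ (¬? (v ∈? C)) * κ v)
        ≈⟨ sym (∑-scale R (λ v → χ (¬? (v ∈? C)) * κ v)) ⟩
      ∑ (λ v → R * (χ (¬? (v ∈? C)) * κ v))
        ≤⟨ ∑-mono (λ v → ≤-from-difference
          (*-nonNeg (fromℕ-nonNeg (indicator (¬? (v ∈? C)))) (defect-nonNeg v))
        (solve 5 (λ i x r d k → (x :- r) :* (i :* d) := r :* (i :* k)
          :+ i :* ((x :- r) :* d :+ (:- r) :* k)) refl (χ (¬? (v ∈? C))) x R (d v) (κ v))) ⟩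
      ∑ (λ v → (x - R) * (χ (¬? (v ∈? C)) * d v))
        ≈⟨ ∑-scale (x - R) (λ v → χ (¬? (v ∈? C)) * d v) ⟩
      (x - R) * ∑ (λ v → χ (¬? (v ∈? C)) * d v)      ≤⟨ *-monoˡ-≤ (proj₁ 0<x-R) outside-degrees ⟩
      (x - R) * L                                    ∎

    -- With `B = binom x (r + 1)`, the cliques leaving `C` number at most `2 M s² (r + 1) B`, so `C`
    -- keeps at least `(1 - s² - 2 M s² (r + 1)) B`. By `binom-scale` at `u = 4 s`, the target is at
    -- most `(1 - 2 (r + 1) s) B`.
    many-cliques : binom ((1# - fromℕ 4 * s) * x) (suc r) ≤ fromℕ (cliquesIn C)
    many-cliques = *-cancelˡ-≤ (fromℕ-pos 1) (*-cancelˡ-≤ 0<R (begin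
      R * (fromℕ 2 * binom ((1# - fromℕ 4 * s) * x) (suc r))
        ≤⟨ *-monoˡ-≤ 0≤R (binom-scale (proj₁ 0<x) (*-nonNeg (fromℕ-nonNeg 4) 0≤s)
          (suc r) r≤ 4rs≤1) ⟩
      R * ((fromℕ 2 - (1# + R) * (fromℕ 4 * s)) * B)
        ≤⟨ ≤-from-difference (*-nonNeg (*-nonNeg (*-nonNeg (fromℕ-nonNeg 2) 0≤R) 0≤B) slack)
             (solve 3 (λ m s b → (con (+ 1) :+ m) :* (con (+ 2) :* ((con (+ 1) :- s :* s) :* b))
               :- con (+ 2) :* (con (+ 2) :* m :* (s :* s) :*
                 ((con (+ 1) :+ m) :* ((con (+ 1) :+ (con (+ 1) :+ m)) :* b))) :=
                (con (+ 1) :+ m) :* ((con (+ 2) :- (con (+ 1) :+ (con (+ 1) :+ m)) :*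
                  (con (+ 4) :* s)) :* b) :+
                con (+ 2) :* (con (+ 1) :+ m) :* b :*
                  (con (+ 2) :* (con (+ 1) :+ (con (+ 1) :+ m)) :* s :- s :* s :- con (+ 2) :* m :*
                    (s :* s) :* (con (+ 1) :+ (con (+ 1) :+ m)))) refl M s B) ⟩
      R * (fromℕ 2 * ((1# - s * s) * B)) - fromℕ 2 * (fromℕ 2 * M * (s * s) * (R * ((1# + R) * B)))
        ≈⟨ +-congˡ (-‿cong (*-congˡ (*-congˡ R*binom≈))) ⟩
      R * (fromℕ 2 * ((1# - s * s) * B)) - fromℕ 2 * (fromℕ 2 * M * (s * s) * ((x - R) * (x * D)))
        ≤⟨ ≤-from-difference (*-nonNeg (fromℕ-nonNeg 2)
          (+-nonNeg (*-nonNeg 0≤R (+-nonNeg (difference-nonNeg (proj₁ cliques>))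
            (difference-nonNeg cliques≤C))) (difference-nonNeg outside-cliques)))
           (solve 9 (λ m s r z y b q i o → r :* (con (+ 2) :* i) :=
             r :* (con (+ 2) :* ((con (+ 1) :- s :* s) :* b)) :- con (+ 2) :*
               (con (+ 2) :* m :* (s :* s) :* (z :* y)) :+
              con (+ 2) :* (r :* ((q :- (con (+ 1) :- s :* s) :* b) :+ ((i :+ o) :- q))
                :+ (z :* (con (+ 2) :* m :* (s :* s) :* y) :- r :* o)))
             refl M s R (x - R) (x * D) B (fromℕ cliques) (fromℕ (cliquesIn C)) O) ⟩
      R * (fromℕ 2 * fromℕ (cliquesIn C)) ∎))
      where
      B O : ℝ
      B = binom x (suc r)
      O = ∑ (λ v → χ (¬? (v ∈? C)) * κ v)
      0≤B : 0# ≤ B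
      0≤B = binom-nonNeg (suc r) (≤-trans r+1≤x (≤-from-difference (proj₁ 0<1) refl))
      cliques≤C : fromℕ cliques ≤ fromℕ (cliquesIn C) + O
      cliques≤C = ≤-trans (fromℕ-mono-≤ (cliques≤ G C))
        (≤-reflexive (trans (fromℕ-+ (cliquesIn C) _)
        (+-congˡ (restricted-sum (λ v → ¬? (v ∈? C)) (cliqueDegree G)))))
      4Ms+8s≤1 : fromℕ 4 * (M * s) + fromℕ 8 * s ≤ 1#
      4Ms+8s≤1 = ≤-trans (≤-from-difference
        (+-nonNeg (*-nonNeg (fromℕ-nonNeg 8) 0≤Ms) (*-nonNeg (fromℕ-nonNeg 4) 0≤s))
        (solve 2 (λ m s → con (+ 12) :* (m :* s) :+ con (+ 12) :* s := con (+ 4) :* (m :* s)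
          :+ con (+ 8) :* s :+ (con (+ 8) :* (m :* s) :+ con (+ 4) :* s)) refl M s)) 12Ms+12s≤1
      4rs≤1 : fromℕ (suc r) * (fromℕ 4 * s) ≤ 1#
      4rs≤1 = ≤-trans (≤-reflexive
        (solve 2 (λ m s → (con (+ 1) :+ (con (+ 1) :+ m)) :* (con (+ 4) :* s) :=
          con (+ 4) :* (m :* s) :+ con (+ 8) :* s) refl M s)) 4Ms+8s≤1
      0≤1-4s : 0# ≤ 1# - fromℕ 4 * s
      0≤1-4s = difference-nonNeg
        (≤-trans (≤-from-difference (*-nonNeg (fromℕ-nonNeg 4) (+-nonNeg 0≤Ms 0≤s))
        (solve 2 (λ m s → con (+ 4) :* (m :* s) :+ con (+ 8) :* s := con (+ 4) :* s
          :+ con (+ 4) :* (m :* s :+ s)) refl M s)) 4Ms+8s≤1)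
      r≤ : fromℕ (suc r) ≤ (1# - fromℕ 4 * s) * x + 1#
      r≤ = ≤-from-difference (+-nonNeg (*-nonNeg 0≤1-4s 0≤x-R-1) (difference-nonNeg 4rs≤1))
        (solve 3 (λ r s x → (con (+ 1) :- con (+ 4) :* s) :* x :+ con (+ 1) := con (+ 1) :+ r :+
          ((con (+ 1) :- con (+ 4) :* s) :* (x :- (con (+ 1) :+ r))
            :+ (con (+ 1) :- (con (+ 1) :+ r) :* (con (+ 4) :* s)))) refl R s x)
      -- Of `2 (r + 1) s`, one half covers `2 M s² (r + 1)`, as `2 M s ≤ 1`, and the other covers
      -- `s²`, as `s ≤ 1`.
      slack : 0# ≤ fromℕ 2 * (1# + R) * s - s * s - fromℕ 2 * M * (s * s) * (1# + R)
      slack = ≤-trans (+-nonNeg (+-nonNeg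
        (*-nonNeg (*-nonNeg (fromℕ-nonNeg (suc r)) 0≤s) (difference-nonNeg 4Ms+8s≤1))
          (*-nonNeg (*-nonNeg (fromℕ-nonNeg (suc r)) 0≤s)
            (+-nonNeg (*-nonNeg (fromℕ-nonNeg 2) 0≤Ms) (*-nonNeg (fromℕ-nonNeg 8) 0≤s))))
          (+-nonNeg (*-nonNeg 0≤s 0≤R) (*-nonNeg 0≤s (difference-nonNeg s≤1))))
        (≤-reflexive (solve 2 (λ m s → let r = con (+ 1) :+ m in
          (con (+ 1) :+ r) :* s :* (con (+ 1) :- (con (+ 4) :* (m :* s) :+ con (+ 8) :* s))
            :+ (con (+ 1) :+ r) :* s :* (con (+ 2) :* (m :* s) :+ con (+ 8) :* s)
              :+ (s :* r :+ s :* (con (+ 1) :- s))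
          := con (+ 2) :* (con (+ 1) :+ r) :* s :- s :* s :- con (+ 2) :* m :* (s :* s) :*
            (con (+ 1) :+ r)) refl M s))

    -- Adjusting the set to exactly `⌈x⌉` vertices

    -- Otherwise the members alone would push the degree sum to `D |S|`, beyond `x D`.
    low-degree-member : ∀ S → x < fromℕ ∣ S ∣ → ∃[ v ] v ∈ S × d v ≤ D
    low-degree-member S x<∣S∣ with Finₚ.any? (λ v → (v ∈? S) ×-dec (d v ≤? D))
    ... | yes found = found
    ... | no none = ⊥-elim (<⇒≱ (*-monoˡ-< 0<D x<∣S∣) (begin
      D * fromℕ ∣ S ∣
        ≈⟨ *-congˡ (trans (∣S∣-sumℝ S) (Sumℝ.sum-cong-≋ (λ v → sym (*-identityʳ (χ (v ∈? S)))))) ⟩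
      D * ∑ (λ v → χ (v ∈? S) * 1#)
        ≤⟨ restricted-bound (_∈? S) D (λ _ → 1#) d (λ v → fromℕ-nonNeg (degree v))
        (λ v v∈S → ≤-trans (≤-reflexive (*-identityʳ D))
          (proj₁ (≰⇒> (λ d≤D → none (v , v∈S , d≤D))))) ⟩
      ∑ d                         ≈⟨ trans ∑d≈xD (*-comm x D) ⟩
      D * x                       ∎))

    -- While more than `q ≥ x` vertices remain, one of degree at most `D` can be deleted, and each
    -- deletion loses at most `D` edges. The surplus `j` drives the recursion.
    trim : ∀ {q} → x ≤ fromℕ q → ∀ j S → ∣ S ∣ ≡ j ℕ.+ q →
      ∃[ S′ ] ∣ S′ ∣ ≡ q × fromℕ (edgesNotIn S′) ≤ fromℕ (edgesNotIn S) + fromℕ j * D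
    trim x≤q zero S ∣S∣≡q = S , ∣S∣≡q , ≤-reflexive
      (solve 2 (λ e b → e := e :+ con (+ 0) :* b) refl (fromℕ (edgesNotIn S)) D)
    trim {q} x≤q (suc j) S ∣S∣≡
      with low-degree-member S (≤-<-trans x≤q
        (fromℕ-mono-< (ℕₚ.≤-trans (s≤s (ℕₚ.m≤n+m q j)) (ℕₚ.≤-reflexive (≡.sym ∣S∣≡)))))
    ... | v , v∈S , d≤D with trim x≤q j (toggle v S)
      (ℕₚ.suc-injective (≡.trans (∣toggle∣-∈ v S v∈S) ∣S∣≡))
    ... | S′ , ∣S′∣≡q , e′≤ = S′ , ∣S′∣≡q , (begin
      fromℕ (edgesNotIn S′)                                ≤⟨ e′≤ ⟩
      fromℕ (edgesNotIn (toggle v S)) + fromℕ j * D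
        ≤⟨ +-monoˡ-≤ (fromℕ j * D)
          (≤-trans (fromℕ-mono-≤ (edgesNotIn-toggle G v S))
          (≤-reflexive (fromℕ-+ (edgesNotIn S) _))) ⟩
      fromℕ (edgesNotIn S) + d v + fromℕ j * D
        ≤⟨ ≤-from-difference (difference-nonNeg d≤D)
        (solve 4 (λ e d j b → e :+ (con (+ 1) :+ j) :* b := e :+ d :+ j :* b :+ (b :- d)) refl
          (fromℕ (edgesNotIn S)) (d v) (fromℕ j) D) ⟩
      fromℕ (edgesNotIn S) + fromℕ (suc j) * D             ∎)

    -- With fewer than `x` vertices there would be fewer than `binom x r` sets of size `r`, hence
    -- too few edges.
    x≤order : x ≤ fromℕ order
    x≤order with x ≤? fromℕ order
    ... | yes x≤n = x≤n
    ... | no  x≰n = ⊥-elim (<⇒≱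
      (binom-mono-< {order} (≰⇒> x≰n) m
        (<-from-difference (<-≤-trans 0<x-R (≤-from-difference (proj₁ 0<1) refl))
        (solve 2 (λ x r → x :+ con (+ 1) := r :+ (x :- r :+ con (+ 1))) refl x R)))
      (≤-trans (≤-reflexive (sym size≈))
        (≤-trans (fromℕ-mono-≤ (size≤#ofSize G)) (≤-reflexive (#ofSize≈binom order r)))))

    edgesNotIn-C : fromℕ (edgesNotIn C) ≤ L
    edgesNotIn-C = ≤-trans (fromℕ-mono-≤ (edgesNotIn≤ G C))
      (≤-trans (≤-reflexive (restricted-sum (λ v → ¬? (v ∈? C)) degree)) outside-degrees)

    0≤L : 0# ≤ L
    0≤L = *-nonNeg (*-nonNeg (*-nonNeg (fromℕ-nonNeg 2) 0≤M) (*-nonNeg 0≤s 0≤s)) (proj₁ 0<xD)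

    -- One `L` pays for the edges already leaving `C`, the other for trimming: at most `2 M s² x`
    -- vertices are deleted at `D` edges each. If `C` is too small, padding it loses no further
    -- edges.
    approximating-set : ∃[ S ] IsCeiling ∣ S ∣ x × fromℕ (edgesNotIn S) ≤ L + L
    approximating-set with ceiling (proj₁ 0<x) order x≤order
    ... | q , q≤n , isCeiling with ℕₚ.≤-total ∣ C ∣ q
    ... | inj₁ ∣C∣≤q with enlarge (q ℕ.∸ ∣ C ∣) C
      (ℕₚ.≤-trans (ℕₚ.≤-reflexive (ℕₚ.m∸n+n≡m ∣C∣≤q)) q≤n)
    ...   | S , C⊆S , ∣S∣≡ = S , ≡.subst (λ i → IsCeiling i x)
      (≡.sym (≡.trans ∣S∣≡ (ℕₚ.m∸n+n≡m ∣C∣≤q))) isCeiling ,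
            ≤-trans (fromℕ-mono-≤ (edgesNotIn-mono G C⊆S))
              (≤-trans edgesNotIn-C (≤-from-difference 0≤L refl))
    approximating-set | q , q≤n , isCeiling | inj₂ q≤∣C∣ with trim (proj₁ isCeiling) (∣ C ∣ ℕ.∸ q) C
      (≡.sym (ℕₚ.m∸n+n≡m q≤∣C∣))
    ...   | S , ∣S∣≡q , e≤ = S , ≡.subst (λ i → IsCeiling i x) (≡.sym ∣S∣≡q) isCeiling ,
            ≤-trans e≤ (+-mono-≤ edgesNotIn-C (≤-trans (*-monoʳ-≤ 0≤D j≤)
              (≤-reflexive (solve 4 (λ m s x b → con (+ 2) :* m :* (s :* s) :* x :* b :=
                con (+ 2) :* m :* (s :* s) :* (x :* b)) refl M s x D))))
      where
      -- As `x ≤ q`, the surplus over `q` is at most the surplus of `|C|` over `x`.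
      j≤ : fromℕ (∣ C ∣ ℕ.∸ q) ≤ fromℕ 2 * M * (s * s) * x
      j≤ = ≤-from-difference (+-nonNeg (difference-nonNeg ∣C∣≤)
        (difference-nonNeg (proj₁ isCeiling)))
        (trans (solve 4 (λ e x q j → e := j :+ ((x :+ e :- (j :+ q)) :+ (q :- x))) refl
          (fromℕ 2 * M * (s * s) * x) x (fromℕ q) (fromℕ (∣ C ∣ ℕ.∸ q)))
          (+-congˡ (+-congʳ (+-congˡ
            (-‿cong (trans (sym (fromℕ-+ (∣ C ∣ ℕ.∸ q) q))
              (reflexive (cong fromℕ (ℕₚ.m∸n+n≡m q≤∣C∣)))))))))

    -- Since `x D = R binom x r`, the left side is `4 M s` times `R s binom x r`, and `12 M s ≤ 1`
    -- makes `4 M s` less than 10. The parameter `e` becomes `ε ⁻¹`.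
    approximating-set-bound : ∀ {e} → 0# ≤ e → L + L ≤ fromℕ 10 * R * (e + 1#) * s * binom x r
    approximating-set-bound {e} 0≤e = ≤-from-difference
      (*-nonNeg (*-nonNeg (*-nonNeg 0≤R 0≤s)
        (binom-nonNeg r (≤-trans (fromℕ-mono-≤ (ℕₚ.n≤1+n r))
          (≤-trans r+1≤x (≤-from-difference (proj₁ 0<1) refl)))))
        (+-nonNeg (+-nonNeg (*-nonNeg (fromℕ-nonNeg 10) 0≤e) (fromℕ-nonNeg 9))
          (+-nonNeg (difference-nonNeg 12Ms+12s≤1)
            (+-nonNeg (*-nonNeg (fromℕ-nonNeg 8) 0≤Ms) (*-nonNeg (fromℕ-nonNeg 12) 0≤s)))))
      (begin-equality
        fromℕ 10 * R * (e + 1#) * s * b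
          ≈⟨ solve 4 (λ m s e b → let r = con (+ 1) :+ m in con (+ 10) :* r :* (e :+ con (+ 1)) :* s :* b :=
               (con (+ 2) :* m :* (s :* s) :* (r :* b) :+ con (+ 2) :* m :* (s :* s) :* (r :* b)) :+
               r :* s :* b :* (con (+ 10) :* e :+ con (+ 9)
                 :+ (con (+ 1) :- (con (+ 12) :* (m :* s) :+ con (+ 12) :* s)
                   :+ (con (+ 8) :* (m :* s) :+ con (+ 12) :* s))))
               refl M s e b ⟩
        (fromℕ 2 * M * (s * s) * (R * b) + fromℕ 2 * M * (s * s) * (R * b)) + slack
          ≈⟨ +-congʳ (+-cong (*-congˡ (binom-absorption x m)) (*-congˡ (binom-absorption x m))) ⟩
        (L + L) + slack ∎)
      where
      b slack : ℝ
      b = binom x r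
      slack = R * s * b * (fromℕ 10 * e + fromℕ 9 +
        (1# - (fromℕ 12 * (M * s) + fromℕ 12 * s) + (fromℕ 8 * (M * s) + fromℕ 12 * s)))

-- Reducing the hypotheses on `ε` and `δ`

module Hypotheses {c ℓ} (F : CompleteOrderedField c ℓ) where
  open OrderedField F

  square≈ : ∀ {s δ} → IsSqrt s δ → s * s ≈ δ
  square≈ {s} (_ , s²≈δ) = trans (*-congˡ (sym (*-identityʳ s))) s²≈δ

  -- Comparing squares gives `s ≤ ε / (6 r)`, whence `12 r s ≤ 2 ε`, and `ε < 1/2`.
  12rs≤1 : ∀ {ε δ s} k → 0# < ε → ε < 1# / fromℕ 2 → δ <
    (ε / (fromℕ 6 * fromℕ (suc k))) ^ 2 → IsSqrt s δ →
    fromℕ 12 * fromℕ (suc k) * s ≤ 1#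
  12rs≤1 {ε} {δ} {s} k 0<ε ε<½ δ<q² sqrt = begin
    fromℕ 12 * R * s
      ≤⟨ *-monoˡ-≤ (*-nonNeg (fromℕ-nonNeg 12) (fromℕ-nonNeg (suc k))) s≤q ⟩
    fromℕ 12 * R * q
      ≈⟨ solve 3 (λ r e i → con (+ 12) :* r :* (e :* i) := con (+ 2) :* e :* (con (+ 6) :* r :* i))
        refl R ε (6R ⁻¹) ⟩
    fromℕ 2 * ε * (6R * 6R ⁻¹)
      ≈⟨ trans (*-congˡ (*-inverseʳ 6R (pos⇒≉0 0<6R))) (*-identityʳ _) ⟩
    fromℕ 2 * ε                            ≤⟨ *-monoˡ-≤ (fromℕ-nonNeg 2) (proj₁ ε<½) ⟩
    fromℕ 2 * (1# / fromℕ 2)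
      ≈⟨ trans (*-congˡ (*-identityˡ _)) (*-inverseʳ (fromℕ 2) (pos⇒≉0 (fromℕ-pos 1))) ⟩
    1#                                     ∎
    where
    open import Relation.Binary.Reasoning.PartialOrder poset
    R 6R q : ℝ
    R = fromℕ (suc k)
    6R = fromℕ 6 * R
    q = ε / 6R
    0<6R : 0# < 6R
    0<6R = *-pos (fromℕ-pos 5) (fromℕ-pos k)
    0≤q : 0# ≤ q
    0≤q = *-nonNeg (proj₁ 0<ε) (proj₁ (⁻¹-pos 0<6R))
    s≤q : s ≤ q
    s≤q with s ≤? q
    ... | yes s≤q = s≤q
    ... | no  s≰q = ⊥-elim (<⇒≱ δ<q² (begin
      q * (q * 1#)   ≈⟨ *-congˡ (*-identityʳ q) ⟩
      q * q          ≤⟨ *-mono-≤ 0≤q (proj₁ sqrt) (proj₁ (≰⇒> s≰q)) (proj₁ (≰⇒> s≰q)) ⟩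
      s * s          ≈⟨ square≈ sqrt ⟩
      δ              ∎))

theorem9 : ∀ {c ℓ} (F : CompleteOrderedField c ℓ) →
    let open CompleteOrderedField F in
    (ε : ℝ) → 0# < ε → ε < 1# / fromℕ 2 →
    (r : ℕ) → 2 ≤ℕ r →
    (x : ℝ) → (1# + ε) * fromℕ (r +ℕ 1) ≤ x →
    (δ : ℝ) → δ < (ε / (fromℕ 6 * fromℕ r)) ^ 2 →
    (√δ : ℝ) → IsSqrt √δ δ →
    (G : RGraph r) →
    let open RGraph G in
    fromℕ size ≈ binom x r →
    (1# - δ) * binom x (r +ℕ 1) < fromℕ cliques →
    (∃[ S ] IsCeiling ∣ S ∣ x ×
    fromℕ (edgesNotIn S) ≤ fromℕ 10 * fromℕ r * (ε ⁻¹ + 1#) * √δ * binom x r)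
    ×
    fromℕ (#vertices (λ v → (1# + √δ) * binom (x - 1#) (r ∸ 1) <? fromℕ (degree v)))
    ≤ √δ * x
    ×
    fromℕ (edgesIncidentTo (λ v → fromℕ (degree v) <? binom ((1# - √δ) * (x - 1#)) (r ∸ 1)))
    ≤ √δ * x * binom (x - 1#) (r ∸ 1)
    ×
    (∃[ C ] fromℕ ∣ C ∣ < (1# + fromℕ 3 * fromℕ r * √δ) * x ×
    binom ((1# - fromℕ 4 * √δ) * x) (r +ℕ 1) ≤ fromℕ (cliquesIn C))
theorem9 F ε 0<ε ε<½ (suc (suc k)) (s≤s (s≤s z≤n)) x x≥ δ δ<q² s sqrt G size≈ cliques>
  -- For `r = k + 2`, `r +ℕ 1` computes only to `suc (suc (k +ℕ 1))`; the rewrite turns it into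
  -- `suc r`.
  rewrite ℕₚ.+-comm k 1 =
  (proj₁ S , proj₁ (proj₂ S) , ≤-trans (proj₂ (proj₂ S)) (approximating-set-bound (proj₁ (⁻¹-pos 0<ε)))) ,
  few-high , low-edges , C , ∣C∣< , many-cliques
  where
  open OrderedField F
  open Hypotheses F
  r+1≤x : fromℕ (suc (suc (suc k))) ≤ x
  r+1≤x = ≤-trans (≤-from-difference (*-nonNeg (proj₁ 0<ε) (fromℕ-nonNeg (suc (suc (suc k)))))
    (solve 2 (λ e q → (con (+ 1) :+ e) :* q := q :+ e :* q) refl ε (fromℕ (suc (suc (suc k)))))) x≥
  open Stability F
  open NearExtremal k x s (proj₁ sqrt) (12rs≤1 (suc k) 0<ε ε<½ δ<q² sqrt) r+1≤x G size≈
    (≤-<-trans (≤-reflexive (*-congʳ (+-congˡ (-‿cong (square≈ sqrt))))) cliques>)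
  S = approximating-set
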